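{- Let $(I,J,K)$ be a reduced triple and let $\mathcal{V}$ be the corresponding variety of Wajsberg hoops, i.e. $\mathcal{V}=\mathsf{V}(\{\mathbf{S}_i:i\in I\}\cup\{\mathbf{S}_j^\omega:j\in J\})$ if $K=\emptyset$, and $\mathcal{V}=\mathsf{V}(\{\mathbf{S}_i:i\in I\}\cup\{\mathbf{S}^\omega\})$ if $K=\{0\}$. For each multiplicative separation $\Pi=(I_1,I_2,J_1,J_2)$ of $(I,J,K)$ there exists a term $t_\Pi(x)$ in the language $\{\cdot,\to,\top\}$, which can be effectively calculated, such that - $\mathbf{S}_i\vDash t_\Pi(x)\approx x$ and $\mathbf{S}_j^\omega\vDash t_\Pi(x)\approx x$ for all $i\in I_1$, $j\in J_1$; - $\mathbf{S}_i\vDash t_\Pi(x)\approx x^i$ for all $i\in I_2$; - $\mathbf{S}_j^\omega\vDash t_\Pi(x)\approx x\cdot((x^{j+1}\to x^{2(j+1)})\to x^{j+1})$ for all $j\in J_2$; - if $K=\{0\}$, then $\mathbf{S}^\omega\vDash t_\Pi(x)\approx x$. Hence, $t_\Pi(x)$ is a multiplicative conucleus on $\mathcal{V}$.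
   Context: A hoop is an algebra $\langle A,\cdot,\to,\top\rangle$ such that $\langle A,\cdot,\top\rangle$ is a commutative monoid and $x\to x=\top$, $x\cdot(x\to y)=y\cdot(y\to x)$, $x\to(y\to z)=(x\cdot y)\to z$; it is partially ordered by $x\le y$ iff $x\to y=\top$. A Wajsberg hoop is a hoop satisfying $(x\to y)\to y\approx(y\to x)\to x$. $\mathsf{V}(\mathcal{K})$ is the variety generated by $\mathcal{K}$. Powers: $a^0=\top$, $a^{n+1}=a^n\cdot a$. $\mathbb{N}=\{1,2,\dots\}$, $\mathbb{N}_0=\mathbb{N}\cup\{0\}$. A multiplicative conucleus on a hoop $\mathbf{A}$ is a map $\delta\colon A\to A$ that is an interior operator ($\delta(a)\le a$, $\delta$ monotone, $\delta\delta=\delta$) with $\delta(a\cdot b)=\delta(a)\cdot\delta(b)$ for all $a,b$. A term $t(x)$ is a multiplicative conucleus on a variety $\mathcal{V}$ if its interpretation $t^{\mathbf{A}}$ is a multiplicative conucleus on $\mathbf{A}$ for every $\mathbf{A}\in\mathcal{V}$. Wajsberg hoops used: - For $n\in\mathbb{N}$, $\mathbf{S}_n$ has universe $\{0,\frac1n,\dots,\frac{n-1}n,1\}$, with $x\cdot y=\max\{x+y-1,0\}$, $x\to y=\min\{y-x+1,1\}$, $\top=1$. - $\mathbf{S}^\omega=\langle\mathbb{N}_0,+,\to,0\rangle$ with $i\to j=\max\{j-i,0\}$ (so $+$ plays the role of $\cdot$ and $0$ of $\top$). - For $n\in\mathbb{N}$, $\mathbf{S}_n^\omega$ has universe the interval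 $[(0,0),(n,0)]$ of $\mathbb{Z}^2$ in the lexicographic order, with $x\cdot y=\neg(\neg x\oplus\neg y)$, $x\to y=\neg x\oplus y$, $\top=(n,0)$, where $x\oplus y=\min\{x+y,(n,0)\}$ and $\neg x=(n,0)-x$. A reduced triple is $(I,J,K)$ with $I,J$ finite subsets of $\mathbb{N}$ and $K\subseteq\{0\}$ such that: $I\cup J\cup K\ne\emptyset$; if $K=\{0\}$ then $J=\emptyset$; for all $i\in I$ and $i'\in(I\setminus\{i\})\cup J$, $i$ does not divide $i'$; for all $j\in J$ and $j'\in J\setminus\{j\}$, $j$ does not divide $j'$. A multiplicative separation of $(I,J,K)$ is a tuple $(I_1,I_2,J_1,J_2)$ with $I_1,I_2\subseteq I$, $J_1,J_2\subseteq J$, $I_1\cup I_2=I$, $I_1\cap I_2=\emptyset$, $(J_1,J_2)\in\{(J,\emptyset),(\emptyset,J)\}$, and $\gcd(k,l)=1$ for all $k\in I_1\cup J_1$, $l\in I_2\cup J_2$. "Effectively calculated" means that there is an algorithm producing $t_\Pi(x)$ from the finite data $(I,J,K)$ and $\Pi$. -}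

module Defs where

open import Level using (Level; 0ℓ; _⊔_) renaming (suc to lsuc)

open import Algebra.Core using (Op₁; Op₂)
open import Algebra.Bundles using (AbelianGroup)
import Algebra.Construct.DirectProduct as DirectProduct
import Algebra.Construct.NaturalChoice.Min as NaturalMin
import Algebra.Properties.AbelianGroup as AbelianGroupProperties
open import Algebra.Structures using (IsCommutativeMonoid)
open import Data.Fin.Base using (Fin; zero; toℕ; fromℕ; fromℕ<)
import Data.Fin.Properties as Fin
open import Data.Integer.Base as ℤ using (ℤ; +_)
import Data.Integer.Properties as ℤ
open import Data.List.Base using (List; []; _∷_; _++_)
open import Data.List.Membership.Propositional using (_∈_)
open import Data.List.Relation.Binary.BagAndSetEquality using (_∼[_]_; set)
open import Data.List.Relation.Binary.Disjoint.Propositional using (Disjoint)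
open import Data.List.Relation.Binary.Subset.Propositional using (_⊆_)
open import Data.List.Relation.Unary.All using (All)
open import Data.Nat.Base as ℕ using (ℕ; zero; suc; _∸_; NonZero; s≤s)
open import Data.Nat.Divisibility using (_∣_)
open import Data.Nat.GCD using (gcd)
import Data.Nat.Properties as ℕ
open import Data.Product.Base using (Σ-syntax; _×_; _,_; proj₁; proj₂)
open import Data.Product.Relation.Binary.Lex.NonStrict using (×-totalOrder)
open import Data.Rational.Unnormalised.Base as ℚᵘ using (ℚᵘ; 0ℚᵘ; 1ℚᵘ; _≃_)
import Data.Rational.Unnormalised.Properties as ℚᵘ
open import Data.Sum.Base using (_⊎_; inj₁; inj₂)
open import Relation.Binary.Bundles using (TotalOrder)
open import Relation.Binary.Core using (Rel)
open import Relation.Binary.PropositionalEquality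
  using (_≡_; _≢_; refl; sym; trans; cong; cong₂; subst; module ≡-Reasoning)
import Relation.Binary.PropositionalEquality as ≡
open import Relation.Binary.Structures using (IsEquivalence)
open import Relation.Nullary using (¬_; yes; no)
open import Relation.Unary using (Pred)

private
  variable
    c ℓ κ : Level
    X : Set

record Algebra (c ℓ : Level) : Set (lsuc (c ⊔ ℓ)) where
  infixl 7 _·_
  infixr 6 _⇒_
  infix  4 _≈_ _≤_
  field
    Carrier       : Set c
    _≈_           : Rel Carrier ℓ
    _·_           : Op₂ Carrier
    _⇒_           : Op₂ Carrier
    ⊤             : Carrier
    isEquivalence : IsEquivalence _≈_
    ·-cong        : ∀ {x x′ y y′} → x ≈ x′ → y ≈ y′ → x · y ≈ x′ · y′
    ⇒-cong        : ∀ {x x′ y y′} → x ≈ x′ → y ≈ y′ → x ⇒ y ≈ x′ ⇒ y′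

  _≤_ : Rel Carrier ℓ
  x ≤ y = x ⇒ y ≈ ⊤

record IsHoop (A : Algebra c ℓ) : Set (c ⊔ ℓ) where
  open Algebra A
  field
    isCommutativeMonoid : IsCommutativeMonoid _≈_ _·_ ⊤
    ⇒-self              : ∀ x → x ⇒ x ≈ ⊤
    divisible           : ∀ x y → x · (x ⇒ y) ≈ y · (y ⇒ x)
    residual            : ∀ x y z → x ⇒ (y ⇒ z) ≈ (x · y) ⇒ z

record WajsbergHoop (c ℓ : Level) : Set (lsuc (c ⊔ ℓ)) where
  field
    algebra : Algebra c ℓ
  open Algebra algebra
  field
    isHoop   : IsHoop algebra
    wajsberg : ∀ x y → (x ⇒ y) ⇒ y ≈ (y ⇒ x) ⇒ x

infixl 7 _·ᵗ_
infixr 6 _⇒ᵗ_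
infixr 8 _^ᵗ_

data Term (X : Set) : Set where
  var  : X → Term X
  _·ᵗ_ : Term X → Term X → Term X
  _⇒ᵗ_ : Term X → Term X → Term X
  ⊤ᵗ   : Term X

_^ᵗ_ : Term X → ℕ → Term X
s ^ᵗ zero  = ⊤ᵗ
s ^ᵗ suc n = s ^ᵗ n ·ᵗ s

module _ (A : Algebra c ℓ) where
  open Algebra A

  ⟦_⟧ : Term X → (X → Carrier) → Carrier
  ⟦ var x ⟧  ρ = ρ x
  ⟦ s ·ᵗ t ⟧ ρ = ⟦ s ⟧ ρ · ⟦ t ⟧ ρ
  ⟦ s ⇒ᵗ t ⟧ ρ = ⟦ s ⟧ ρ ⇒ ⟦ t ⟧ ρ
  ⟦ ⊤ᵗ ⟧     ρ = ⊤

  infix 4 _⊨_≈ᵗ_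
  _⊨_≈ᵗ_ : Term X → Term X → Set (c ⊔ ℓ)
  _⊨_≈ᵗ_ s t = ∀ ρ → ⟦ s ⟧ ρ ≈ ⟦ t ⟧ ρ

UnaryTerm : Set
UnaryTerm = Term (Fin 1)

𝕩 : UnaryTerm
𝕩 = var zero

unaryOp : (A : Algebra c ℓ) → UnaryTerm → Op₁ (Algebra.Carrier A)
unaryOp A t a = ⟦_⟧ A t (λ _ → a)

Identity : Set
Identity = Term ℕ × Term ℕ

Models : Pred Identity 0ℓ → Algebra c ℓ → Set (c ⊔ ℓ)
Models E A = ∀ s t → E (s , t) → _⊨_≈ᵗ_ A s t

-- A variety is the class of models of a set of identities, and V 𝒦 is the
-- least variety containing 𝒦.  Its members are not required to be hoops
-- beforehand: the hoop and Wajsberg laws are identities holding in 𝒦.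
V : Pred (WajsbergHoop 0ℓ 0ℓ) κ → Pred (Algebra c ℓ) (lsuc 0ℓ ⊔ κ ⊔ c ⊔ ℓ)
V 𝒦 A = (E : Pred Identity 0ℓ) →
        (∀ B → 𝒦 B → Models E (WajsbergHoop.algebra B)) →
        Models E A

-- Only the operations and the relation ≤ matter here, so these are defined on
-- every algebra of the type of hoops; δ-cong says that δ is a map of setoids.
record IsInteriorOperator (A : Algebra c ℓ) (δ : Op₁ (Algebra.Carrier A)) :
                          Set (c ⊔ ℓ) where
  open Algebra A
  field
    δ-cong       : ∀ {a b} → a ≈ b → δ a ≈ δ b
    deflationary : ∀ a → δ a ≤ a
    monotone     : ∀ {a b} → a ≤ b → δ a ≤ δ b
    idempotent   : ∀ a → δ (δ a) ≈ δ a

record IsMultiplicativeConucleus (A : Algebra c ℓ)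
                                 (δ : Op₁ (Algebra.Carrier A)) :
                                 Set (c ⊔ ℓ) where
  open Algebra A
  field
    isInteriorOperator : IsInteriorOperator A δ
    multiplicative     : ∀ a b → δ (a · b) ≈ δ a · δ b

-- k : Fin (suc n) stands for the rational k / n, so that max{x + y − 1, 0}
-- and min{y − x + 1, 1} become the operations below on numerators; see
-- value-· and value-⇒.  (𝐒 0 is the one-element algebra; reduced triples only
-- involve n ≥ 1.  The same applies to 𝐒ω 0.)
module 𝐒-operations (n : ℕ) where

  infixl 7 _·_
  infixr 6 _⇒_

  bound : ∀ (k : Fin (suc n)) → toℕ k ℕ.≤ n
  bound k = ℕ.≤-pred (Fin.toℕ<n k)

  _·_ : Op₂ (Fin (suc n))
  k · l = fromℕ< {(toℕ k ℕ.+ toℕ l) ∸ n} (s≤s (begin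
    (toℕ k ℕ.+ toℕ l) ∸ n ≤⟨ ℕ.∸-monoˡ-≤ n (ℕ.+-monoˡ-≤ (toℕ l) (bound k)) ⟩
    (n ℕ.+ toℕ l) ∸ n     ≡⟨ ℕ.m+n∸m≡n n (toℕ l) ⟩
    toℕ l                 ≤⟨ bound l ⟩
    n                     ∎))
    where open ℕ.≤-Reasoning

  _⇒_ : Op₂ (Fin (suc n))
  k ⇒ l = fromℕ< {((n ℕ.+ toℕ l) ∸ toℕ k) ℕ.⊓ n}
                 (s≤s (ℕ.m⊓n≤n ((n ℕ.+ toℕ l) ∸ toℕ k) n))

  ⊤ : Fin (suc n)
  ⊤ = fromℕ n

  toℕ-· : ∀ k l → toℕ (k · l) ≡ (toℕ k ℕ.+ toℕ l) ∸ n
  toℕ-· k l = Fin.toℕ-fromℕ< _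

  toℕ-⇒ : ∀ k l → toℕ (k ⇒ l) ≡ ((n ℕ.+ toℕ l) ∸ toℕ k) ℕ.⊓ n
  toℕ-⇒ k l = Fin.toℕ-fromℕ< _

  module Law where
    open ≡-Reasoning

    mul imp : Op₂ ℕ
    mul a b = (a ℕ.+ b) ∸ n
    imp a b = ((n ℕ.+ b) ∸ a) ℕ.⊓ n

    imp-≤ : ∀ {a b} → a ℕ.≤ b → imp a b ≡ n
    imp-≤ {a} {b} a≤b = ℕ.m≥n⇒m⊓n≡n (ℕ.m+n≤o⇒m≤o∸n n (ℕ.+-monoʳ-≤ n a≤b))

    imp-≥ : ∀ {a b} → b ℕ.≤ a → imp a b ≡ (n ℕ.+ b) ∸ a
    imp-≥ {a} {b} b≤a = ℕ.m≤n⇒m⊓n≡m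
      (ℕ.m≤n+o⇒m∸n≤o (n ℕ.+ b) a
        (ℕ.≤-trans (ℕ.+-monoʳ-≤ n b≤a) (ℕ.≤-reflexive (ℕ.+-comm n a))))

    mul-assoc : ∀ {a b c} → a ℕ.≤ n → c ℕ.≤ n →
                mul (mul a b) c ≡ mul a (mul b c)
    mul-assoc {a} {b} {c} a≤n c≤n = begin
      ((a ℕ.+ b) ∸ n ℕ.+ c) ∸ n       ≡⟨ half (a ℕ.+ b) c≤n ⟩
      ((a ℕ.+ b) ℕ.+ c) ∸ (n ℕ.+ n)   ≡⟨ cong (_∸ (n ℕ.+ n)) rearrange ⟩
      ((b ℕ.+ c) ℕ.+ a) ∸ (n ℕ.+ n)   ≡⟨ half (b ℕ.+ c) a≤n ⟨
      ((b ℕ.+ c) ∸ n ℕ.+ a) ∸ n       ≡⟨ cong (_∸ n) (ℕ.+-comm _ a) ⟩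
      (a ℕ.+ ((b ℕ.+ c) ∸ n)) ∸ n     ∎
      where
      rearrange : (a ℕ.+ b) ℕ.+ c ≡ (b ℕ.+ c) ℕ.+ a
      rearrange = trans (ℕ.+-assoc a b c) (ℕ.+-comm a (b ℕ.+ c))
      half : ∀ s {d} → d ℕ.≤ n → (s ∸ n ℕ.+ d) ∸ n ≡ (s ℕ.+ d) ∸ (n ℕ.+ n)
      half s {d} d≤n with ℕ.≤-total n s
      ... | inj₁ n≤s = trans (cong (_∸ n) (sym (ℕ.+-∸-comm d n≤s)))
                             (ℕ.∸-+-assoc (s ℕ.+ d) n n)
      ... | inj₂ s≤n = begin
        (s ∸ n ℕ.+ d) ∸ n       ≡⟨ cong (λ z → (z ℕ.+ d) ∸ n) (ℕ.m≤n⇒m∸n≡0 s≤n) ⟩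
        d ∸ n                   ≡⟨ ℕ.m≤n⇒m∸n≡0 d≤n ⟩
        0                       ≡⟨ ℕ.m≤n⇒m∸n≡0 (ℕ.+-mono-≤ s≤n d≤n) ⟨
        (s ℕ.+ d) ∸ (n ℕ.+ n)   ∎

    mul-imp : ∀ {a b} → a ℕ.≤ n → mul a (imp a b) ≡ a ℕ.⊓ b
    mul-imp {a} {b} a≤n with ℕ.≤-total a b
    ... | inj₁ a≤b = begin
      (a ℕ.+ imp a b) ∸ n       ≡⟨ cong (mul a) (imp-≤ a≤b) ⟩
      (a ℕ.+ n) ∸ n             ≡⟨ ℕ.m+n∸n≡m a n ⟩
      a                         ≡⟨ ℕ.m≤n⇒m⊓n≡m a≤b ⟨
      a ℕ.⊓ b                   ∎
    ... | inj₂ b≤a = begin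
      (a ℕ.+ imp a b) ∸ n             ≡⟨ cong (mul a) (imp-≥ b≤a) ⟩
      (a ℕ.+ ((n ℕ.+ b) ∸ a)) ∸ n     ≡⟨ cong (_∸ n) (ℕ.m+[n∸m]≡n (ℕ.m≤n⇒m≤n+o b a≤n)) ⟩
      (n ℕ.+ b) ∸ n                   ≡⟨ ℕ.m+n∸m≡n n b ⟩
      b                               ≡⟨ ℕ.m≥n⇒m⊓n≡n b≤a ⟨
      a ℕ.⊓ b                         ∎

    imp-imp : ∀ {a b} → a ℕ.≤ n → b ℕ.≤ n → imp (imp a b) b ≡ a ℕ.⊔ b
    imp-imp {a} {b} a≤n b≤n with ℕ.≤-total a b
    ... | inj₁ a≤b = begin
      imp (imp a b) b           ≡⟨ cong (λ z → imp z b) (imp-≤ a≤b) ⟩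
      imp n b                   ≡⟨ imp-≥ b≤n ⟩
      (n ℕ.+ b) ∸ n             ≡⟨ ℕ.m+n∸m≡n n b ⟩
      b                         ≡⟨ ℕ.m≤n⇒m⊔n≡n a≤b ⟨
      a ℕ.⊔ b                   ∎
    ... | inj₂ b≤a = begin
      imp (imp a b) b                          ≡⟨ cong (λ z → imp z b) (imp-≥ b≤a) ⟩
      ((n ℕ.+ b) ∸ ((n ℕ.+ b) ∸ a)) ℕ.⊓ n      ≡⟨ cong (ℕ._⊓ n) (ℕ.m∸[m∸n]≡n (ℕ.m≤n⇒m≤n+o b a≤n)) ⟩
      a ℕ.⊓ n                                  ≡⟨ ℕ.m≤n⇒m⊓n≡m a≤n ⟩
      a                                        ≡⟨ ℕ.m≥n⇒m⊔n≡m b≤a ⟨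
      a ℕ.⊔ b                                  ∎

    imp-mul : ∀ {a b c} → a ℕ.≤ n → b ℕ.≤ n →
              imp a (imp b c) ≡ imp (mul a b) c
    imp-mul {a} {b} {c} a≤n b≤n with ℕ.≤-total b c
    ... | inj₁ b≤c = begin
      imp a (imp b c)           ≡⟨ cong (imp a) (imp-≤ b≤c) ⟩
      imp a n                   ≡⟨ imp-≤ a≤n ⟩
      n                         ≡⟨ imp-≤ (ℕ.≤-trans mul≤b b≤c) ⟨
      imp (mul a b) c           ∎
      where
      mul≤b : mul a b ℕ.≤ b
      mul≤b = ℕ.m≤n+o⇒m∸n≤o (a ℕ.+ b) n (ℕ.+-monoˡ-≤ b a≤n)
    ... | inj₂ c≤b with ℕ.≤-total n (a ℕ.+ b)
    ...   | inj₁ n≤a+b = begin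
      ((n ℕ.+ imp b c) ∸ a) ℕ.⊓ n               ≡⟨ cong (λ z → ((n ℕ.+ z) ∸ a) ℕ.⊓ n) (imp-≥ c≤b) ⟩
      ((n ℕ.+ ((n ℕ.+ c) ∸ b)) ∸ a) ℕ.⊓ n       ≡⟨ cong (λ z → (z ∸ a) ℕ.⊓ n) (ℕ.+-∸-assoc n (ℕ.m≤n⇒m≤n+o c b≤n)) ⟨
      (((n ℕ.+ (n ℕ.+ c)) ∸ b) ∸ a) ℕ.⊓ n       ≡⟨ cong (ℕ._⊓ n) (ℕ.∸-+-assoc _ b a) ⟩
      ((n ℕ.+ (n ℕ.+ c)) ∸ (b ℕ.+ a)) ℕ.⊓ n     ≡⟨ cong (λ z → ((n ℕ.+ (n ℕ.+ c)) ∸ z) ℕ.⊓ n) b+a ⟩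
      ((n ℕ.+ (n ℕ.+ c)) ∸ (n ℕ.+ mul a b)) ℕ.⊓ n ≡⟨ cong (ℕ._⊓ n) (ℕ.[m+n]∸[m+o]≡n∸o n (n ℕ.+ c) (mul a b)) ⟩
      ((n ℕ.+ c) ∸ mul a b) ℕ.⊓ n               ∎
      where
      b+a : b ℕ.+ a ≡ n ℕ.+ mul a b
      b+a = trans (ℕ.+-comm b a) (sym (ℕ.m+[n∸m]≡n n≤a+b))
    ...   | inj₂ a+b≤n = begin
      imp a (imp b c)       ≡⟨ imp-≤ a≤imp ⟩
      n                     ≡⟨ imp-≤ ℕ.z≤n ⟨
      imp 0 c               ≡⟨ cong (λ z → imp z c) (ℕ.m≤n⇒m∸n≡0 a+b≤n) ⟨
      imp (mul a b) c       ∎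
      where
      a≤imp : a ℕ.≤ imp b c
      a≤imp = ℕ.≤-trans (ℕ.m+n≤o⇒m≤o∸n a (ℕ.m≤n⇒m≤n+o c a+b≤n))
                        (ℕ.≤-reflexive (sym (imp-≥ c≤b)))

  open Law
  open ≡-Reasoning

  ·-comm : ∀ k l → k · l ≡ l · k
  ·-comm k l = Fin.toℕ-injective (begin
    toℕ (k · l)           ≡⟨ toℕ-· k l ⟩
    mul (toℕ k) (toℕ l)   ≡⟨ cong (_∸ n) (ℕ.+-comm (toℕ k) (toℕ l)) ⟩
    mul (toℕ l) (toℕ k)   ≡⟨ toℕ-· l k ⟨
    toℕ (l · k)           ∎)

  ·-assoc : ∀ k l m → (k · l) · m ≡ k · (l · m)
  ·-assoc k l m = Fin.toℕ-injective (begin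
    toℕ ((k · l) · m)                   ≡⟨ toℕ-· (k · l) m ⟩
    mul (toℕ (k · l)) (toℕ m)           ≡⟨ cong (λ z → mul z (toℕ m)) (toℕ-· k l) ⟩
    mul (mul (toℕ k) (toℕ l)) (toℕ m)   ≡⟨ mul-assoc {toℕ k} {toℕ l} (bound k) (bound m) ⟩
    mul (toℕ k) (mul (toℕ l) (toℕ m))   ≡⟨ cong (mul (toℕ k)) (toℕ-· l m) ⟨
    mul (toℕ k) (toℕ (l · m))           ≡⟨ toℕ-· k (l · m) ⟨
    toℕ (k · (l · m))                   ∎)

  ·-identityˡ : ∀ k → ⊤ · k ≡ k
  ·-identityˡ k = Fin.toℕ-injective (begin
    toℕ (⊤ · k)           ≡⟨ toℕ-· ⊤ k ⟩
    mul (toℕ ⊤) (toℕ k)   ≡⟨ cong (λ z → mul z (toℕ k)) (Fin.toℕ-fromℕ n) ⟩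
    mul n (toℕ k)         ≡⟨ ℕ.m+n∸m≡n n (toℕ k) ⟩
    toℕ k                 ∎)

  ⇒-self : ∀ k → k ⇒ k ≡ ⊤
  ⇒-self k = Fin.toℕ-injective (begin
    toℕ (k ⇒ k)           ≡⟨ toℕ-⇒ k k ⟩
    imp (toℕ k) (toℕ k)   ≡⟨ imp-≤ {toℕ k} ℕ.≤-refl ⟩
    n                     ≡⟨ Fin.toℕ-fromℕ n ⟨
    toℕ ⊤                 ∎)

  toℕ-·-⇒ : ∀ k l → toℕ (k · (k ⇒ l)) ≡ toℕ k ℕ.⊓ toℕ l
  toℕ-·-⇒ k l = begin
    toℕ (k · (k ⇒ l))                   ≡⟨ toℕ-· k (k ⇒ l) ⟩
    mul (toℕ k) (toℕ (k ⇒ l))           ≡⟨ cong (mul (toℕ k)) (toℕ-⇒ k l) ⟩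
    mul (toℕ k) (imp (toℕ k) (toℕ l))   ≡⟨ mul-imp (bound k) ⟩
    toℕ k ℕ.⊓ toℕ l                     ∎

  toℕ-⇒-⇒ : ∀ k l → toℕ ((k ⇒ l) ⇒ l) ≡ toℕ k ℕ.⊔ toℕ l
  toℕ-⇒-⇒ k l = begin
    toℕ ((k ⇒ l) ⇒ l)                   ≡⟨ toℕ-⇒ (k ⇒ l) l ⟩
    imp (toℕ (k ⇒ l)) (toℕ l)           ≡⟨ cong (λ z → imp z (toℕ l)) (toℕ-⇒ k l) ⟩
    imp (imp (toℕ k) (toℕ l)) (toℕ l)   ≡⟨ imp-imp (bound k) (bound l) ⟩
    toℕ k ℕ.⊔ toℕ l                     ∎

  residual : ∀ k l m → k ⇒ (l ⇒ m) ≡ (k · l) ⇒ m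
  residual k l m = Fin.toℕ-injective (begin
    toℕ (k ⇒ (l ⇒ m))                   ≡⟨ toℕ-⇒ k (l ⇒ m) ⟩
    imp (toℕ k) (toℕ (l ⇒ m))           ≡⟨ cong (imp (toℕ k)) (toℕ-⇒ l m) ⟩
    imp (toℕ k) (imp (toℕ l) (toℕ m))   ≡⟨ imp-mul {c = toℕ m} (bound k) (bound l) ⟩
    imp (mul (toℕ k) (toℕ l)) (toℕ m)   ≡⟨ cong (λ z → imp z (toℕ m)) (toℕ-· k l) ⟨
    imp (toℕ (k · l)) (toℕ m)           ≡⟨ toℕ-⇒ (k · l) m ⟨
    toℕ ((k · l) ⇒ m)                   ∎)

  wajsbergHoop : WajsbergHoop 0ℓ 0ℓ
  wajsbergHoop = record
    { algebra = record
      { Carrier = Fin (suc n) ; _≈_ = _≡_ ; _·_ = _·_ ; _⇒_ = _⇒_ ; ⊤ = ⊤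
      ; isEquivalence = ≡.isEquivalence
      ; ·-cong = cong₂ _·_
      ; ⇒-cong = cong₂ _⇒_
      }
    ; isHoop = record
      { isCommutativeMonoid = record
        { isMonoid = record
          { isSemigroup = record
            { isMagma = record
              { isEquivalence = ≡.isEquivalence ; ∙-cong = cong₂ _·_ }
            ; assoc = ·-assoc
            }
          ; identity = ·-identityˡ , λ k → trans (·-comm k ⊤) (·-identityˡ k)
          }
        ; comm = ·-comm
        }
      ; ⇒-self = ⇒-self
      ; divisible = λ k l → Fin.toℕ-injective (trans (toℕ-·-⇒ k l)
          (trans (ℕ.⊓-comm (toℕ k) (toℕ l)) (sym (toℕ-·-⇒ l k))))
      ; residual = residual
      }
    ; wajsberg = λ k l → Fin.toℕ-injective (trans (toℕ-⇒-⇒ k l)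
        (trans (ℕ.⊔-comm (toℕ k) (toℕ l)) (sym (toℕ-⇒-⇒ l k))))
    }

𝐒 : ℕ → WajsbergHoop 0ℓ 0ℓ
𝐒 n = 𝐒-operations.wajsbergHoop n

module 𝐒-value (m : ℕ) where

  open 𝐒-operations (suc m)

  value : Fin (suc (suc m)) → ℚᵘ
  value k = + toℕ k ℚᵘ./ suc m

  private
    N : ℤ
    N = + suc m

    frac : ℤ → ℚᵘ
    frac i = i ℚᵘ./ suc m

    frac-mono : ∀ {i j} → i ℤ.≤ j → frac i ℚᵘ.≤ frac j
    frac-mono i≤j = ℚᵘ.*≤* (ℤ.*-monoʳ-≤-nonNeg N i≤j)

    frac-+ : ∀ i j → frac i ℚᵘ.+ frac j ≃ frac (i ℤ.+ j)
    frac-+ i j = ℚᵘ.*≡* (begin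
      (i ℤ.* N ℤ.+ j ℤ.* N) ℤ.* N   ≡⟨ cong (ℤ._* N) (ℤ.*-distribʳ-+ N i j) ⟨
      ((i ℤ.+ j) ℤ.* N) ℤ.* N       ≡⟨ ℤ.*-assoc (i ℤ.+ j) N N ⟩
      (i ℤ.+ j) ℤ.* (N ℤ.* N)       ∎)
      where open ≡-Reasoning

    1≃N/N : 1ℚᵘ ≃ frac N
    1≃N/N = ℚᵘ.*≡* (ℤ.*-comm (+ 1) N)

    -1≃-N/N : ℚᵘ.- 1ℚᵘ ≃ frac (ℤ.- N)
    -1≃-N/N = ℚᵘ.-‿cong 1≃N/N

    0≃0/N : 0ℚᵘ ≃ frac (+ 0)
    0≃0/N = ℚᵘ.*≡* refl

  value-⊤ : value ⊤ ≃ 1ℚᵘ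
  value-⊤ = ℚᵘ.≃-trans (ℚᵘ.≃-reflexive (cong (λ z → frac (+ z)) (Fin.toℕ-fromℕ (suc m))))
                       (ℚᵘ.≃-sym 1≃N/N)

  value-injective : ∀ k l → value k ≃ value l → k ≡ l
  value-injective k l (ℚᵘ.*≡* eq) =
    Fin.toℕ-injective (ℤ.+-injective (ℤ.*-cancelʳ-≡ (+ toℕ k) (+ toℕ l) N eq))

  value-· : ∀ k l → value (k · l) ≃ (value k ℚᵘ.+ value l ℚᵘ.- 1ℚᵘ) ℚᵘ.⊔ 0ℚᵘ
  value-· k l = ℚᵘ.≃-trans (ℚᵘ.≃-reflexive (cong (λ z → frac (+ z)) (toℕ-· k l)))
                           (ℚᵘ.≃-sym (ℚᵘ.≃-trans (ℚᵘ.⊔-cong sum 0≃0/N) cut))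
    where
    s : ℕ
    s = toℕ k ℕ.+ toℕ l
    sum : value k ℚᵘ.+ value l ℚᵘ.- 1ℚᵘ ≃ frac (+ s ℤ.- N)
    sum = ℚᵘ.≃-trans (ℚᵘ.+-cong (frac-+ (+ toℕ k) (+ toℕ l)) -1≃-N/N)
                     (frac-+ (+ s) (ℤ.- N))
    cut : frac (+ s ℤ.- N) ℚᵘ.⊔ frac (+ 0) ≃ frac (+ (s ∸ suc m))
    cut with ℕ.≤-total (suc m) s
    ... | inj₁ n≤s = ℚᵘ.≃-trans
      (ℚᵘ.p≥q⇒p⊔q≃p (frac-mono (subst (+ 0 ℤ.≤_) (sym eq) (ℤ.+≤+ ℕ.z≤n))))
      (ℚᵘ.≃-reflexive (cong frac eq))
      where
      eq : + s ℤ.- N ≡ + (s ∸ suc m)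
      eq = trans (ℤ.[+m]-[+n]≡m⊖n s (suc m)) (ℤ.⊖-≥ n≤s)
    ... | inj₂ s≤n = ℚᵘ.≃-trans
      (ℚᵘ.p≤q⇒p⊔q≃q (frac-mono (ℤ.i≤j⇒i-j≤0 (ℤ.+≤+ s≤n))))
      (ℚᵘ.≃-reflexive (cong (λ z → frac (+ z)) (sym (ℕ.m≤n⇒m∸n≡0 s≤n))))

  value-⇒ : ∀ k l → value (k ⇒ l) ≃ (value l ℚᵘ.- value k ℚᵘ.+ 1ℚᵘ) ℚᵘ.⊓ 1ℚᵘ
  value-⇒ k l = ℚᵘ.≃-trans (ℚᵘ.≃-reflexive (cong (λ z → frac (+ z)) (toℕ-⇒ k l)))
                           (ℚᵘ.≃-sym (ℚᵘ.≃-trans (ℚᵘ.⊓-cong sum 1≃N/N) cut))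
    where
    open ≡-Reasoning
    a b d : ℕ
    a = toℕ k
    b = toℕ l
    d = (suc m ℕ.+ b) ∸ a
    eq : (+ b ℤ.- + a) ℤ.+ N ≡ + d
    eq = begin
      (+ b ℤ.- + a) ℤ.+ N       ≡⟨ ℤ.+-comm (+ b ℤ.- + a) N ⟩
      N ℤ.+ (+ b ℤ.- + a)       ≡⟨ ℤ.+-assoc N (+ b) (ℤ.- + a) ⟨
      + (suc m ℕ.+ b) ℤ.- + a   ≡⟨ ℤ.[+m]-[+n]≡m⊖n (suc m ℕ.+ b) a ⟩
      (suc m ℕ.+ b) ℤ.⊖ a       ≡⟨ ℤ.⊖-≥ (ℕ.m≤n⇒m≤n+o b (ℕ.≤-pred (Fin.toℕ<n k))) ⟩
      + d                       ∎
    sum : value l ℚᵘ.- value k ℚᵘ.+ 1ℚᵘ ≃ frac (+ d)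
    sum = ℚᵘ.≃-trans (ℚᵘ.+-cong (frac-+ (+ b) (ℤ.- + a)) 1≃N/N)
          (ℚᵘ.≃-trans (frac-+ (+ b ℤ.- + a) N) (ℚᵘ.≃-reflexive (cong frac eq)))
    cut : frac (+ d) ℚᵘ.⊓ frac N ≃ frac (+ (d ℕ.⊓ suc m))
    cut with ℕ.≤-total d (suc m)
    ... | inj₁ d≤n = ℚᵘ.≃-trans (ℚᵘ.p≤q⇒p⊓q≃p (frac-mono (ℤ.+≤+ d≤n)))
      (ℚᵘ.≃-reflexive (cong (λ z → frac (+ z)) (sym (ℕ.m≤n⇒m⊓n≡m d≤n))))
    ... | inj₂ n≤d = ℚᵘ.≃-trans (ℚᵘ.p≥q⇒p⊓q≃q (frac-mono (ℤ.+≤+ n≤d)))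
      (ℚᵘ.≃-reflexive (cong (λ z → frac (+ z)) (sym (ℕ.m≥n⇒m⊓n≡n n≤d))))

𝐒^ω : WajsbergHoop 0ℓ 0ℓ
𝐒^ω = record
  { algebra = record
    { Carrier = ℕ ; _≈_ = _≡_ ; _·_ = ℕ._+_ ; _⇒_ = λ i j → j ∸ i ; ⊤ = 0
    ; isEquivalence = ≡.isEquivalence
    ; ·-cong = cong₂ ℕ._+_
    ; ⇒-cong = cong₂ (λ i j → j ∸ i)
    }
  ; isHoop = record
    { isCommutativeMonoid = ℕ.+-0-isCommutativeMonoid
    ; ⇒-self = ℕ.n∸n≡0
    ; divisible = λ i j → trans (join i j) (trans (ℕ.⊔-comm i j) (sym (join j i)))
    ; residual = λ i j k → trans (ℕ.∸-+-assoc k j i)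
        (cong (k ∸_) (ℕ.+-comm j i))
    }
  ; wajsberg = λ i j → trans (meet j i) (trans (ℕ.⊓-comm j i) (sym (meet i j)))
  }
  where
  join : ∀ i j → i ℕ.+ (j ∸ i) ≡ i ℕ.⊔ j
  join i j with ℕ.≤-total i j
  ... | inj₁ i≤j = trans (ℕ.m+[n∸m]≡n i≤j) (sym (ℕ.m≤n⇒m⊔n≡n i≤j))
  ... | inj₂ j≤i = trans (cong (i ℕ.+_) (ℕ.m≤n⇒m∸n≡0 j≤i))
                         (trans (ℕ.+-identityʳ i) (sym (ℕ.m≥n⇒m⊔n≡m j≤i)))
  meet : ∀ i j → i ∸ (i ∸ j) ≡ i ℕ.⊓ j
  meet i j with ℕ.≤-total i j
  ... | inj₁ i≤j = trans (cong (i ∸_) (ℕ.m≤n⇒m∸n≡0 i≤j)) (sym (ℕ.m≤n⇒m⊓n≡m i≤j))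
  ... | inj₂ j≤i = trans (ℕ.m∸[m∸n]≡n j≤i) (sym (ℕ.m≥n⇒m⊓n≡n j≤i))

ℤ²-abelianGroup : AbelianGroup 0ℓ 0ℓ
ℤ²-abelianGroup = DirectProduct.abelianGroup ℤ.+-0-abelianGroup ℤ.+-0-abelianGroup

ℤ²-lexicographic : TotalOrder 0ℓ 0ℓ 0ℓ
ℤ²-lexicographic = ×-totalOrder ℤ.≤-decTotalOrder ℤ.≤-totalOrder

module 𝐒ω-operations (n : ℕ) where

  open AbelianGroup ℤ²-abelianGroup
    renaming (Carrier to ℤ²; _≈_ to _≈²_; _∙_ to _+²_; ε to 0²; _⁻¹ to -²_
             ; refl to ≈-refl; sym to ≈-sym; trans to ≈-trans
             ; isEquivalence to ≈-isEquivalence)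
  open TotalOrder ℤ²-lexicographic using ()
    renaming (_≤_ to _≤²_; refl to ≤-refl; trans to ≤-trans; total to ≤-total
             ; ≤-respˡ-≈ to ≤-respˡ; ≤-respʳ-≈ to ≤-respʳ)
  open NaturalMin ℤ²-lexicographic using (⊓-cong; ⊓-glb; x⊓y≤y)
    renaming (_⊓_ to min²; x≤y⇒x⊓y≈x to min-≤; x≤y⇒y⊓x≈x to min-≥)

  u : ℤ²
  u = + n , + 0

  Universe : Set
  Universe = Σ[ x ∈ ℤ² ] (0² ≤² x × x ≤² u)

  infix 4 _≈_
  _≈_ : Rel Universe 0ℓ
  x ≈ y = proj₁ x ≈² proj₁ y

  open AbelianGroupProperties ℤ²-abelianGroup
    using (//-rightDividesˡ; //-rightDividesʳ; ⁻¹-anti-homo-//; xyx⁻¹≈y; ⁻¹-∙-comm)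
  open import Relation.Binary.Reasoning.Setoid setoid

  +-monoˡ : ∀ {x y} z → x ≤² y → x +² z ≤² y +² z
  +-monoˡ z (inj₁ (x₁≤y₁ , x₁≢y₁)) =
    inj₁ (ℤ.+-monoˡ-≤ (proj₁ z) x₁≤y₁ , λ eq → x₁≢y₁ (∙-cancelʳ _ _ _ eq))
    where open AbelianGroupProperties ℤ.+-0-abelianGroup using (∙-cancelʳ)
  +-monoˡ z (inj₂ (x₁≡y₁ , x₂≤y₂)) =
    inj₂ (cong (ℤ._+ proj₁ z) x₁≡y₁ , ℤ.+-monoˡ-≤ (proj₂ z) x₂≤y₂)

  +-monoʳ : ∀ x {y z} → y ≤² z → x +² y ≤² x +² z
  +-monoʳ x {y} {z} y≤z =
    ≤-respˡ (comm y x) (≤-respʳ (comm z x) (+-monoˡ x y≤z))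

  ≤-+ʳ : ∀ {x} y → 0² ≤² x → y ≤² y +² x
  ≤-+ʳ y 0≤x = ≤-respˡ (identityʳ y) (+-monoʳ y 0≤x)

  neg² : ℤ² → ℤ²
  neg² x = u +² -² x

  plus² : ℤ² → ℤ² → ℤ²
  plus² x y = min² (x +² y) u

  infixl 6 _⊕_
  infix  8 ¬′_
  infixl 7 _·_
  infixr 5 _⇒_

  0′ ⊤ : Universe
  0′ = 0² , ≤-refl , 0≤u
    where
    0≤u : 0² ≤² u
    0≤u with ℤ.+ 0 ℤ.≟ + n
    ... | yes eq = inj₂ (eq , ℤ.≤-refl)
    ... | no neq = inj₁ (ℤ.+≤+ ℕ.z≤n , neq)
  ⊤ = u , proj₂ (proj₂ 0′) , ≤-refl

  ¬′_ : Op₁ Universe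
  ¬′ (x , 0≤x , x≤u) = neg² x
    , ≤-respˡ (inverseʳ x) (+-monoˡ (-² x) x≤u)
    , ≤-respʳ (//-rightDividesˡ x u) (≤-+ʳ (neg² x) 0≤x)

  _⊕_ : Op₂ Universe
  (x , 0≤x , _) ⊕ (y , 0≤y , _) = plus² x y
    , ⊓-glb (≤-trans 0≤x (≤-+ʳ x 0≤y)) (proj₁ (proj₂ ⊤))
    , x⊓y≤y (x +² y) u

  _·_ : Op₂ Universe
  x · y = ¬′ (¬′ x ⊕ ¬′ y)

  _⇒_ : Op₂ Universe
  x ⇒ y = ¬′ x ⊕ y

  ¬-cong : ∀ {x y} → x ≈ y → ¬′ x ≈ ¬′ y
  ¬-cong x≈y = ∙-congˡ {u} (⁻¹-cong x≈y)

  ⊕-cong : ∀ {x x′ y y′} → x ≈ x′ → y ≈ y′ → x ⊕ y ≈ x′ ⊕ y′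
  ⊕-cong x≈x′ y≈y′ = ⊓-cong (∙-cong x≈x′ y≈y′) (≈-refl {u})

  ¬-involutive : ∀ x → ¬′ ¬′ x ≈ x
  ¬-involutive (x , _) = begin
    u +² -² (u +² -² x)   ≈⟨ ∙-congˡ {u} (⁻¹-anti-homo-// u x) ⟩
    u +² (x +² -² u)      ≈⟨ assoc u x (-² u) ⟨
    (u +² x) +² -² u      ≈⟨ xyx⁻¹≈y u x ⟩
    x                     ∎

  ⊕-comm : ∀ x y → x ⊕ y ≈ y ⊕ x
  ⊕-comm (x , _) (y , _) = ⊓-cong (comm x y) (≈-refl {u})

  absorb : ∀ s {z} → 0² ≤² z → min² (min² s u +² z) u ≈² min² (s +² z) u
  absorb s {z} 0≤z with ≤-total s u
  ... | inj₁ s≤u = ≈-refl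
  ... | inj₂ u≤s = ≈-trans (min-≥ (≤-+ʳ u 0≤z))
    (≈-sym (min-≥ (≤-trans u≤s (≤-+ʳ s 0≤z))))

  ⊕-assoc : ∀ x y z → (x ⊕ y) ⊕ z ≈ x ⊕ (y ⊕ z)
  ⊕-assoc (x , 0≤x , _) (y , _) (z , 0≤z , _) = begin
    min² (min² (x +² y) u +² z) u   ≈⟨ absorb (x +² y) 0≤z ⟩
    min² ((x +² y) +² z) u          ≈⟨ ⊓-cong (≈-trans (assoc x y z) (comm x (y +² z))) ≈-refl ⟩
    min² ((y +² z) +² x) u          ≈⟨ absorb (y +² z) 0≤x ⟨
    min² (min² (y +² z) u +² x) u   ≈⟨ ⊓-cong (comm _ x) ≈-refl ⟩
    min² (x +² min² (y +² z) u) u   ∎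

  ⊕-identityˡ : ∀ {z} x → z ≈ 0′ → z ⊕ x ≈ x
  ⊕-identityˡ {z , _} (x , _ , x≤u) z≈0 = begin
    min² (z +² x) u    ≈⟨ ⊓-cong (∙-congʳ {x} z≈0) ≈-refl ⟩
    min² (0² +² x) u   ≈⟨ ⊓-cong (identityˡ x) ≈-refl ⟩
    min² x u           ≈⟨ min-≤ x≤u ⟩
    x                  ∎

  ⇒-top : ∀ x y → proj₁ x ≤² proj₁ y → x ⇒ y ≈ ⊤
  ⇒-top (x , _) (y , _) x≤y =
    min-≥ (≤-respˡ (//-rightDividesˡ x u) (+-monoʳ (neg² x) x≤y))

  ⇒-⇒-≤ : ∀ x y → proj₁ x ≤² proj₁ y → (x ⇒ y) ⇒ y ≈ y
  ⇒-⇒-≤ x y x≤y = ⊕-identityˡ {¬′ (x ⇒ y)} y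
    (≈-trans (¬-cong {x ⇒ y} {⊤} (⇒-top x y x≤y)) (inverseʳ u))

  ⇒-⇒-≥ : ∀ x y → proj₁ y ≤² proj₁ x → (x ⇒ y) ⇒ y ≈ x
  ⇒-⇒-≥ (x , 0≤x , x≤u) (y , _) y≤x = begin
    min² (neg² (min² w u) +² y) u           ≈⟨ ⊓-cong (∙-congʳ {y} (∙-congˡ {u} (⁻¹-cong (min-≤ w≤u)))) ≈-refl ⟩
    min² ((u +² -² w) +² y) u               ≈⟨ ⊓-cong cancel ≈-refl ⟩
    min² x u                                ≈⟨ min-≤ x≤u ⟩
    x                                       ∎
    where
    w : ℤ²
    w = neg² x +² y
    w≤u : w ≤² u
    w≤u = ≤-respʳ (//-rightDividesˡ x u) (+-monoʳ (neg² x) y≤x)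
    cancel : (u +² -² w) +² y ≈² x
    cancel = begin
      (u +² -² (neg² x +² y)) +² y          ≈⟨ ∙-congʳ {y} (∙-congˡ {u} (⁻¹-∙-comm (neg² x) y)) ⟨
      (u +² (-² neg² x +² -² y)) +² y       ≈⟨ ∙-congʳ {y} (assoc u (-² neg² x) (-² y)) ⟨
      ((u +² -² neg² x) +² -² y) +² y       ≈⟨ //-rightDividesˡ y (u +² -² neg² x) ⟩
      u +² -² neg² x                        ≈⟨ ¬-involutive (x , 0≤x , x≤u) ⟩
      x                                     ∎

  wajsberg : ∀ x y → (x ⇒ y) ⇒ y ≈ (y ⇒ x) ⇒ x
  wajsberg x y with ≤-total (proj₁ x) (proj₁ y)
  ... | inj₁ x≤y = ≈-trans (⇒-⇒-≤ x y x≤y) (≈-sym (⇒-⇒-≥ y x x≤y))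
  ... | inj₂ y≤x = ≈-trans (⇒-⇒-≥ x y y≤x) (≈-sym (⇒-⇒-≤ y x y≤x))

  ·-cong : ∀ {x x′ y y′} → x ≈ x′ → y ≈ y′ → x · y ≈ x′ · y′
  ·-cong {x} {x′} {y} {y′} x≈x′ y≈y′ = ¬-cong {¬′ x ⊕ ¬′ y} {¬′ x′ ⊕ ¬′ y′}
    (⊕-cong {¬′ x} {¬′ x′} {¬′ y} {¬′ y′}
      (¬-cong {x} {x′} x≈x′) (¬-cong {y} {y′} y≈y′))

  ⇒-cong : ∀ {x x′ y y′} → x ≈ x′ → y ≈ y′ → x ⇒ y ≈ x′ ⇒ y′
  ⇒-cong {x} {x′} {y} {y′} x≈x′ =
    ⊕-cong {¬′ x} {¬′ x′} {y} {y′} (¬-cong {x} {x′} x≈x′)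

  ·-comm : ∀ x y → x · y ≈ y · x
  ·-comm x y = ¬-cong {¬′ x ⊕ ¬′ y} {¬′ y ⊕ ¬′ x} (⊕-comm (¬′ x) (¬′ y))

  residual : ∀ x y z → x ⇒ (y ⇒ z) ≈ (x · y) ⇒ z
  residual x y z = begin
    proj₁ (¬′ x ⊕ (¬′ y ⊕ z))         ≈⟨ ⊕-assoc (¬′ x) (¬′ y) z ⟨
    proj₁ ((¬′ x ⊕ ¬′ y) ⊕ z)         ≈⟨ ⊕-cong {¬′ ¬′ s} {s} {z} {z} (¬-involutive s) ≈-refl ⟨
    proj₁ (¬′ (x · y) ⊕ z)            ∎
    where
    s : Universe
    s = ¬′ x ⊕ ¬′ y

  ·-assoc : ∀ x y z → (x · y) · z ≈ x · (y · z)
  ·-assoc x y z = ¬-cong {¬′ (x · y) ⊕ ¬′ z} {¬′ x ⊕ ¬′ (y · z)} (begin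
    proj₁ (¬′ (x · y) ⊕ ¬′ z)         ≈⟨ residual x y (¬′ z) ⟨
    proj₁ (¬′ x ⊕ (¬′ y ⊕ ¬′ z))      ≈⟨ ⊕-cong {¬′ x} {¬′ x} {¬′ ¬′ s} {s} ≈-refl (¬-involutive s) ⟨
    proj₁ (¬′ x ⊕ ¬′ (y · z))         ∎)
    where
    s : Universe
    s = ¬′ y ⊕ ¬′ z

  ·-identityˡ : ∀ x → ⊤ · x ≈ x
  ·-identityˡ x = ≈-trans
    (¬-cong {¬′ ⊤ ⊕ ¬′ x} {¬′ x} (⊕-identityˡ {¬′ ⊤} (¬′ x) (inverseʳ u)))
    (¬-involutive x)

  contrapositive : ∀ x y → x ⇒ y ≈ ¬′ y ⇒ ¬′ x
  contrapositive x y = begin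
    proj₁ (¬′ x ⊕ y)                  ≈⟨ ⊕-comm (¬′ x) y ⟩
    proj₁ (y ⊕ ¬′ x)                  ≈⟨ ⊕-cong {¬′ ¬′ y} {y} {¬′ x} {¬′ x} (¬-involutive y) ≈-refl ⟨
    proj₁ (¬′ ¬′ y ⊕ ¬′ x)            ∎

  ·-⇒ : ∀ x y → x · (x ⇒ y) ≈ ¬′ ((¬′ y ⇒ ¬′ x) ⇒ ¬′ x)
  ·-⇒ x y = ¬-cong {¬′ x ⊕ ¬′ (x ⇒ y)} {¬′ (¬′ y ⇒ ¬′ x) ⊕ ¬′ x} (begin
    proj₁ (¬′ x ⊕ ¬′ (x ⇒ y))         ≈⟨ ⊕-comm (¬′ x) (¬′ (x ⇒ y)) ⟩
    proj₁ (¬′ (x ⇒ y) ⊕ ¬′ x)         ≈⟨ ⇒-cong {x ⇒ y} {¬′ y ⇒ ¬′ x} {¬′ x} {¬′ x} (contrapositive x y) ≈-refl ⟩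
    proj₁ (¬′ (¬′ y ⇒ ¬′ x) ⊕ ¬′ x)   ∎)

  divisible : ∀ x y → x · (x ⇒ y) ≈ y · (y ⇒ x)
  divisible x y = begin
    proj₁ (x · (x ⇒ y))                     ≈⟨ ·-⇒ x y ⟩
    proj₁ (¬′ ((¬′ y ⇒ ¬′ x) ⇒ ¬′ x))       ≈⟨ ¬-cong {(¬′ y ⇒ ¬′ x) ⇒ ¬′ x} {(¬′ x ⇒ ¬′ y) ⇒ ¬′ y} (wajsberg (¬′ y) (¬′ x)) ⟩
    proj₁ (¬′ ((¬′ x ⇒ ¬′ y) ⇒ ¬′ y))       ≈⟨ ·-⇒ y x ⟨
    proj₁ (y · (y ⇒ x))                     ∎

  ≈-equiv : IsEquivalence _≈_
  ≈-equiv = record { refl = ≈-refl ; sym = ≈-sym ; trans = ≈-trans }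

  wajsbergHoop : WajsbergHoop 0ℓ 0ℓ
  wajsbergHoop = record
    { algebra = record
      { Carrier = Universe ; _≈_ = _≈_ ; _·_ = _·_ ; _⇒_ = _⇒_ ; ⊤ = ⊤
      ; isEquivalence = ≈-equiv
      ; ·-cong = λ {x} {x′} {y} {y′} → ·-cong {x} {x′} {y} {y′}
      ; ⇒-cong = λ {x} {x′} {y} {y′} → ⇒-cong {x} {x′} {y} {y′}
      }
    ; isHoop = record
      { isCommutativeMonoid = record
        { isMonoid = record
          { isSemigroup = record
            { isMagma = record
              { isEquivalence = ≈-equiv
              ; ∙-cong = λ {x} {x′} {y} {y′} → ·-cong {x} {x′} {y} {y′}
              }
            ; assoc = ·-assoc
            }
          ; identity = ·-identityˡ
                     , λ x → ≈-trans (·-comm x ⊤) (·-identityˡ x)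
          }
        ; comm = ·-comm
        }
      ; ⇒-self = λ x → ⇒-top x x ≤-refl
      ; divisible = divisible
      ; residual = residual
      }
    ; wajsberg = wajsberg
    }

𝐒ω : ℕ → WajsbergHoop 0ℓ 0ℓ
𝐒ω n = 𝐒ω-operations.wajsbergHoop n

-- Finite subsets of ℕ are lists, used only through membership and set
-- equality, so order and repetitions are immaterial.
record Triple : Set where
  field
    I J K : List ℕ

record IsReduced (T : Triple) : Set where
  open Triple T
  field
    I-positive  : All NonZero I
    J-positive  : All NonZero J
    K⊆0         : K ⊆ 0 ∷ []
    nonempty    : I ++ J ++ K ≢ []
    K⇒J-empty   : 0 ∈ K → J ≡ []
    I-antichain : ∀ {i i′} → i ∈ I → (i′ ∈ I × i′ ≢ i) ⊎ i′ ∈ J → ¬ (i ∣ i′)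
    J-antichain : ∀ {j j′} → j ∈ J → j′ ∈ J → j′ ≢ j → ¬ (j ∣ j′)

data Generator (T : Triple) : Pred (WajsbergHoop 0ℓ 0ℓ) (lsuc 0ℓ) where
  finite    : ∀ {i} → i ∈ Triple.I T → Generator T (𝐒 i)
  infinite  : ∀ {j} → Triple.K T ≡ [] → j ∈ Triple.J T → Generator T (𝐒ω j)
  unbounded : 0 ∈ Triple.K T → Generator T 𝐒^ω

𝒱 : Triple → Pred (Algebra c ℓ) (lsuc 0ℓ ⊔ c ⊔ ℓ)
𝒱 T = V (Generator T)

record Quadruple : Set where
  field
    I₁ I₂ J₁ J₂ : List ℕ

record IsMultiplicativeSeparation (T : Triple) (Π : Quadruple) : Set where
  open Triple T
  open Quadruple Π
  field
    I₁⊆I     : I₁ ⊆ I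
    I₂⊆I     : I₂ ⊆ I
    J₁⊆J     : J₁ ⊆ J
    J₂⊆J     : J₂ ⊆ J
    I-union  : I₁ ++ I₂ ∼[ set ] I
    I-disj   : Disjoint I₁ I₂
    J-choice : (J₁ ∼[ set ] J × J₂ ≡ []) ⊎ (J₁ ≡ [] × J₂ ∼[ set ] J)
    coprime  : ∀ {k l} → k ∈ I₁ ++ J₁ → l ∈ I₂ ++ J₂ → gcd k l ≡ 1

infix 4 _⊨_≈_
_⊨_≈_ : WajsbergHoop 0ℓ 0ℓ → UnaryTerm → UnaryTerm → Set
A ⊨ s ≈ t = _⊨_≈ᵗ_ (WajsbergHoop.algebra A) s t

_isMultiplicativeConucleusOn_ : UnaryTerm → Pred (Algebra c ℓ) κ →
                                Set (lsuc (c ⊔ ℓ) ⊔ κ)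
t isMultiplicativeConucleusOn 𝒲 =
  ∀ A → 𝒲 A → IsMultiplicativeConucleus A (unaryOp A t)

module Submission where

open import Defs
open import Level using (Level)
open import Data.List.Membership.Propositional using (_∈_)
open import Data.Nat.Base using (suc; _*_)
open import Data.Product.Base using (Σ-syntax; _×_)

open import Level using (0ℓ; _⊔_)
open import Algebra.Bundles using (AbelianGroup)
import Algebra.Construct.NaturalChoice.Min as NaturalMin
import Algebra.Properties.AbelianGroup as AbelianGroupProperties
open import Algebra.Structures using (IsCommutativeMonoid)
open import Data.Fin.Base using (Fin; zero; toℕ)
import Data.Fin.Properties as Fin
import Data.Integer.Base as ℤ
import Data.Integer.Properties as ℤ
open import Data.List.Base using (List; []; _∷_; _++_; filter; foldr; upTo)
open import Data.List.Extrema.Nat using (max; xs≤max)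
open import Data.List.Membership.Propositional using (find; lose)
open import Data.List.Membership.Propositional.Properties
  using (∈-++⁺ˡ; ∈-++⁺ʳ; ∈-++⁻; ∈-filter⁺; ∈-filter⁻; ∈-upTo⁺)
import Data.List.Relation.Unary.All as All
open import Data.List.Relation.Unary.Any using (Any; here; there; any?)
open import Data.Nat.Base as ℕ
  using (ℕ; zero; _+_; _∸_; _⊓_; _≤_; _<_; ∣_-_∣; s≤s; ≢-nonZero; ≢-nonZero⁻¹)
open import Data.Nat.Divisibility using (_∣_; divides; _∣?_; ∣⇒≤; ∣1⇒≡1)
open import Data.Nat.GCD
open import Data.Nat.Properties
open import Data.Product.Base using (∃-syntax; _,_; proj₁; proj₂)
open import Data.Sum.Base using (_⊎_; inj₁; inj₂; [_,_]′)
open import Function.Base using (id; _∘_)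
open import Function.Bundles using (Equivalence)
open import Relation.Binary.Bundles using (Setoid; TotalOrder)
open import Relation.Binary.PropositionalEquality
  using (_≡_; _≢_; refl; sym; trans; cong; cong₂; subst; module ≡-Reasoning)
import Relation.Binary.Reasoning.Setoid as SetoidReasoning
open import Relation.Binary.Structures using (IsEquivalence)
open import Relation.Nullary using (¬_; Dec; yes; no; contradiction; ¬?; _×-dec_)
open import Relation.Unary using (Pred)

-- Count from the top: the corank of a / n is n ∸ a, so that · becomes truncated
-- addition, x ⇒ y becomes truncated subtraction of x from y, and meets and
-- distances are terms.  Subtractive Euclid, started at x and the least element,
-- then computes gcd (c , n), where c is the corank of x; so the reduced
-- denominator q = n / gcd (c , n) of x can be tested by a term.  For x of
-- nonzero corank, q divides n, and q ≠ 1 unless x is near the least element.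
-- By coprimality, asking whether q divides an element of I₁ ∪ J₁ and none of J₂
-- therefore tells the algebras where t is the identity from the others.
--
-- No constant denotes the least element, but ((xᴺ ⇒ x²ᴺ) ⇒ xᴺ) does so for
-- large N unless x is infinitely close to ⊤ (always so in 𝐒^ω), in which case
-- it is ⊤.  The same expression makes the outcome of the test two-valued, even
-- in the presence of infinitesimals.

private
  variable
    ℓ₁ ℓ₂ κ : Level
    X Y : Set

-- Terms for joins, distances, gcds and the selection.

substitute : (X → Term Y) → Term X → Term Y
substitute σ (var x)  = σ x
substitute σ (s ·ᵗ t) = substitute σ s ·ᵗ substitute σ t
substitute σ (s ⇒ᵗ t) = substitute σ s ⇒ᵗ substitute σ t
substitute σ ⊤ᵗ       = ⊤ᵗ

join dist : Term X → Term X → Term X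
join s t = (s ⇒ᵗ t) ⇒ᵗ t
dist s t = (s ⇒ᵗ t) ·ᵗ (t ⇒ᵗ s)

-- For `s` = `𝕩` and N = j + 1 this is the second factor of the formula prescribed on `𝐒ω j` with j
-- in J₂.
boolean : ℕ → Term X → Term X
boolean N s = (s ^ᵗ N ⇒ᵗ s ^ᵗ (2 * N)) ⇒ᵗ s ^ᵗ N

-- The subtractive Euclidean algorithm: in coranks, dist is the distance of two
-- numbers and join is their minimum.
euclid : ℕ → Term X → Term X → Term X
euclid zero    s t = s
euclid (suc N) s t = euclid N (dist s t) (join s t)

-- If b denotes the least element, of corank n, and s has corank y > 0, then
-- this has corank 0 just when (k + 1) y = n.
quotientTest : Term X → Term X → ℕ → Term X
quotientTest b s k = dist (s ^ᵗ k ⇒ᵗ b) s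

-- A disjunction of tests: `join` is the minimum of coranks, corank 0 counts as true, and the
-- default `b` is false.
someQuotient : Term X → Term X → List ℕ → Term X
someQuotient b s = foldr (λ k → join (quotientTest b s k)) b

-- For large N the second factor is ⊤ if x is infinitely close to ⊤ or the test succeeds, and ⊥
-- otherwise, so the value is x or ⊥. The first factor makes the term deflationary.
selector : ℕ → List ℕ → UnaryTerm
selector N D = 𝕩 ·ᵗ join b (boolean N (someQuotient b (euclid N 𝕩 b) D))
  where b = boolean N 𝕩

-- Evaluation of terms under substitution.

module _ (A : Algebra ℓ₁ ℓ₂) where
  open Algebra A
  open IsEquivalence isEquivalence using () renaming (refl to ≈-refl)

  ⟦⟧-cong : ∀ (t : Term X) {ρ ρ′} → (∀ x → ρ x ≈ ρ′ x) → ⟦_⟧ A t ρ ≈ ⟦_⟧ A t ρ′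
  ⟦⟧-cong (var x)  eq = eq x
  ⟦⟧-cong (s ·ᵗ t) eq = ·-cong (⟦⟧-cong s eq) (⟦⟧-cong t eq)
  ⟦⟧-cong (s ⇒ᵗ t) eq = ⇒-cong (⟦⟧-cong s eq) (⟦⟧-cong t eq)
  ⟦⟧-cong ⊤ᵗ       eq = ≈-refl

  ⟦⟧-substitute : ∀ (t : Term X) (σ : X → Term Y) ρ →
                  ⟦_⟧ A (substitute σ t) ρ ≡ ⟦_⟧ A t (λ x → ⟦_⟧ A (σ x) ρ)
  ⟦⟧-substitute (var x)  σ ρ = refl
  ⟦⟧-substitute (s ·ᵗ t) σ ρ = cong₂ _·_ (⟦⟧-substitute s σ ρ) (⟦⟧-substitute t σ ρ)
  ⟦⟧-substitute (s ⇒ᵗ t) σ ρ = cong₂ _⇒_ (⟦⟧-substitute s σ ρ) (⟦⟧-substitute t σ ρ)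
  ⟦⟧-substitute ⊤ᵗ       σ ρ = refl

-- Consequences of the hoop axioms.

module HoopProperties {A : Algebra ℓ₁ ℓ₂} (isHoop : IsHoop A) where
  open Algebra A
  open IsHoop isHoop public
  open IsCommutativeMonoid isCommutativeMonoid public
    using (setoid; identityˡ; identityʳ; assoc; comm)
    renaming (refl to ≈-refl; sym to ≈-sym; trans to ≈-trans; reflexive to ≈-reflexive)
  open SetoidReasoning setoid

  -- Residuation gives y ⇒ (⊤ ⇒ x) ≈ y ⇒ x. Taking y to be ⊤ ⇒ x and x yields both inequalities,
  -- which divisibility turns into an equality.
  ⊤-⇒-identityˡ : ∀ x → ⊤ ⇒ x ≈ x
  ⊤-⇒-identityˡ x = begin
    ⊤ ⇒ x                        ≈⟨ identityʳ _ ⟨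
    (⊤ ⇒ x) · ⊤                  ≈⟨ ·-cong ≈-refl ⊤⇒x≤x ⟨
    (⊤ ⇒ x) · ((⊤ ⇒ x) ⇒ x)      ≈⟨ divisible _ _ ⟩
    x · (x ⇒ (⊤ ⇒ x))            ≈⟨ ·-cong ≈-refl (drop-⊤ x) ⟩
    x · (x ⇒ x)                  ≈⟨ ·-cong ≈-refl (⇒-self x) ⟩
    x · ⊤                        ≈⟨ identityʳ x ⟩
    x                            ∎
    where
    drop-⊤ : ∀ y → y ⇒ (⊤ ⇒ x) ≈ y ⇒ x
    drop-⊤ y = ≈-trans (residual y ⊤ x) (⇒-cong (identityʳ y) ≈-refl)
    ⊤⇒x≤x : (⊤ ⇒ x) ⇒ x ≈ ⊤
    ⊤⇒x≤x = ≈-trans (≈-sym (drop-⊤ (⊤ ⇒ x))) (⇒-self (⊤ ⇒ x))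

  -- Divisibility for ⊤ and x exhibits x as (x ⇒ ⊤) · x, and residuation then leaves an instance of
  -- `⇒-self`.
  ⇒-zeroʳ : ∀ x → x ⇒ ⊤ ≈ ⊤
  ⇒-zeroʳ x = begin
    x ⇒ ⊤                        ≈⟨ ⇒-cong x≈ ≈-refl ⟩
    ((x ⇒ ⊤) · x) ⇒ ⊤            ≈⟨ residual _ _ _ ⟨
    (x ⇒ ⊤) ⇒ (x ⇒ ⊤)            ≈⟨ ⇒-self _ ⟩
    ⊤                            ∎
    where
    x≈ : x ≈ (x ⇒ ⊤) · x
    x≈ = begin
      x                ≈⟨ ⊤-⇒-identityˡ x ⟨
      ⊤ ⇒ x            ≈⟨ identityˡ _ ⟨
      ⊤ · (⊤ ⇒ x)      ≈⟨ divisible _ _ ⟩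
      x · (x ⇒ ⊤)      ≈⟨ comm _ _ ⟩
      (x ⇒ ⊤) · x      ∎

  ·-lowerˡ : ∀ x y → x · y ⇒ x ≈ ⊤
  ·-lowerˡ x y = begin
    x · y ⇒ x        ≈⟨ ⇒-cong (comm x y) ≈-refl ⟩
    y · x ⇒ x        ≈⟨ residual _ _ _ ⟨
    y ⇒ (x ⇒ x)      ≈⟨ ⇒-cong ≈-refl (⇒-self x) ⟩
    y ⇒ ⊤            ≈⟨ ⇒-zeroʳ y ⟩
    ⊤                ∎

  ^ᵗ-+ : ∀ (s : Term X) m k ρ →
         ⟦_⟧ A (s ^ᵗ (m + k)) ρ ≈ ⟦_⟧ A (s ^ᵗ k) ρ · ⟦_⟧ A (s ^ᵗ m) ρ
  ^ᵗ-+ s zero    k ρ = ≈-sym (identityʳ _)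
  ^ᵗ-+ s (suc m) k ρ = ≈-trans (·-cong (^ᵗ-+ s m k ρ) ≈-refl) (assoc _ _ _)

  ⟦boolean⟧ : ∀ N (s : Term X) ρ → let v = ⟦_⟧ A (s ^ᵗ N) ρ in
              ⟦_⟧ A (boolean N s) ρ ≈ (v ⇒ v · v) ⇒ v
  ⟦boolean⟧ N s ρ = ⇒-cong (⇒-cong ≈-refl doubled) ≈-refl
    where
    doubled : ⟦_⟧ A (s ^ᵗ (2 * N)) ρ ≈ ⟦_⟧ A (s ^ᵗ N) ρ · ⟦_⟧ A (s ^ᵗ N) ρ
    doubled = ≈-trans (≈-reflexive (cong (λ k → ⟦_⟧ A (s ^ᵗ (N + k)) ρ) (+-identityʳ N)))
                      (^ᵗ-+ s N N ρ)

  join-⊤ˡ : ∀ {x y} → x ≈ ⊤ → (x ⇒ y) ⇒ y ≈ ⊤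
  join-⊤ˡ {x} {y} x≈⊤ = begin
    (x ⇒ y) ⇒ y      ≈⟨ ⇒-cong (≈-trans (⇒-cong x≈⊤ ≈-refl) (⊤-⇒-identityˡ y)) ≈-refl ⟩
    y ⇒ y            ≈⟨ ⇒-self y ⟩
    ⊤                ∎

  join-⊤ʳ : ∀ {x y} → y ≈ ⊤ → (x ⇒ y) ⇒ y ≈ ⊤
  join-⊤ʳ y≈⊤ = ≈-trans (⇒-cong ≈-refl y≈⊤) (⇒-zeroʳ _)

  join-idem : ∀ {x y} → x ≈ y → (x ⇒ y) ⇒ y ≈ y
  join-idem {x} {y} x≈y = begin
    (x ⇒ y) ⇒ y      ≈⟨ ⇒-cong (⇒-cong x≈y ≈-refl) ≈-refl ⟩
    (y ⇒ y) ⇒ y      ≈⟨ ⇒-cong (⇒-self y) ≈-refl ⟩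
    ⊤ ⇒ y            ≈⟨ ⊤-⇒-identityˡ y ⟩
    y                ∎

-- Arithmetic of truncated subtraction, distance and gcd.

m∸[m∸n]≡m⊓n : ∀ m n → m ∸ (m ∸ n) ≡ m ⊓ n
m∸[m∸n]≡m⊓n m n with ≤-total n m
... | inj₁ n≤m = trans (m∸[m∸n]≡n n≤m) (sym (m≥n⇒m⊓n≡n n≤m))
... | inj₂ m≤n = trans (cong (m ∸_) (m≤n⇒m∸n≡0 m≤n)) (sym (m≤n⇒m⊓n≡m m≤n))

[m∸n]+[n∸m]≡∣m-n∣ : ∀ m n → (m ∸ n) + (n ∸ m) ≡ ∣ m - n ∣
[m∸n]+[n∸m]≡∣m-n∣ zero    zero    = refl
[m∸n]+[n∸m]≡∣m-n∣ zero    (suc n) = refl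
[m∸n]+[n∸m]≡∣m-n∣ (suc m) zero    = cong suc (+-identityʳ m)
[m∸n]+[n∸m]≡∣m-n∣ (suc m) (suc n) = [m∸n]+[n∸m]≡∣m-n∣ m n

-- The termination measure of `euclid`: a step turns the sum of the two coranks into their maximum.
∣m-n∣+m⊓n≡m⊔n : ∀ m n → ∣ m - n ∣ + (m ⊓ n) ≡ m ℕ.⊔ n
∣m-n∣+m⊓n≡m⊔n zero    zero    = refl
∣m-n∣+m⊓n≡m⊔n zero    (suc n) = +-identityʳ _
∣m-n∣+m⊓n≡m⊔n (suc m) zero    = +-identityʳ _
∣m-n∣+m⊓n≡m⊔n (suc m) (suc n) =
  trans (+-suc _ _) (cong suc (∣m-n∣+m⊓n≡m⊔n m n))

-- The invariant of `euclid`; after ordering the arguments it is `GCD.step`.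
gcd-∣-∣-⊓ : ∀ m n → gcd ∣ m - n ∣ (m ⊓ n) ≡ gcd m n
gcd-∣-∣-⊓ m n = [ ordered , swapped ]′ (≤-total m n)
  where
  open ≡-Reasoning
  ordered : ∀ {m n} → m ≤ n → gcd ∣ m - n ∣ (m ⊓ n) ≡ gcd m n
  ordered {m} {n} m≤n = begin
    gcd ∣ m - n ∣ (m ⊓ n)  ≡⟨ cong₂ gcd (m≤n⇒∣m-n∣≡n∸m m≤n) (m≤n⇒m⊓n≡m m≤n) ⟩
    gcd (n ∸ m) m          ≡⟨ gcd-comm (n ∸ m) m ⟩
    gcd m (n ∸ m)          ≡⟨ GCD.unique (GCD.step (gcd-GCD m (n ∸ m))) (gcd-GCD m _) ⟩
    gcd m (m + (n ∸ m))    ≡⟨ cong (gcd m) (m+[n∸m]≡n m≤n) ⟩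
    gcd m n                ∎
  swapped : n ≤ m → gcd ∣ m - n ∣ (m ⊓ n) ≡ gcd m n
  swapped n≤m = begin
    gcd ∣ m - n ∣ (m ⊓ n)  ≡⟨ cong₂ gcd (∣-∣-comm m n) (⊓-comm m n) ⟩
    gcd ∣ n - m ∣ (n ⊓ m)  ≡⟨ ordered n≤m ⟩
    gcd n m                ≡⟨ gcd-comm n m ⟩
    gcd m n                ∎

-- `⊓` binds tighter than `∸`: cutting the subtrahend off at m changes nothing.
m∸n⊓m≡m∸n : ∀ m n → m ∸ n ⊓ m ≡ m ∸ n
m∸n⊓m≡m∸n m n = trans (∸-distribˡ-⊓-⊔ m n m)
  (trans (cong (m ∸ n ℕ.⊔_) (n∸n≡0 m)) (⊔-identityʳ (m ∸ n)))

-- The complement a ↦ n ∸ a carries the product of `𝐒 n` to addition cut off at n; `complement-⇒`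
-- does the same for implication and truncated subtraction.
complement-⊙ : ∀ {n a b} → a ≤ n → b ≤ n →
               n ∸ (a + b ∸ n) ≡ ((n ∸ a) + (n ∸ b)) ⊓ n
complement-⊙ {n} {a} {b} a≤n b≤n = begin
  n ∸ (a + b ∸ n)                     ≡⟨ case-split (≤-total n (a + b)) ⟩
  (n + n ∸ (a + b)) ⊓ n               ≡⟨ cong (_⊓ n) split ⟩
  ((n ∸ a) + (n ∸ b)) ⊓ n             ∎
  where
  open ≡-Reasoning
  split : n + n ∸ (a + b) ≡ (n ∸ a) + (n ∸ b)
  split = begin
    n + n ∸ (a + b)       ≡⟨ ∸-+-assoc (n + n) a b ⟨
    (n + n ∸ a) ∸ b       ≡⟨ cong (_∸ b) (+-∸-comm n a≤n) ⟩
    ((n ∸ a) + n) ∸ b     ≡⟨ +-∸-assoc (n ∸ a) b≤n ⟩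
    (n ∸ a) + (n ∸ b)     ∎
  case-split : n ≤ a + b ⊎ a + b ≤ n → n ∸ (a + b ∸ n) ≡ (n + n ∸ (a + b)) ⊓ n
  case-split (inj₁ n≤s) = begin
    n ∸ (a + b ∸ n)                ≡⟨ cong (_∸ (a + b ∸ n)) (m+n∸n≡m n n) ⟨
    (n + n ∸ n) ∸ (a + b ∸ n)      ≡⟨ ∸-+-assoc (n + n) n (a + b ∸ n) ⟩
    n + n ∸ (n + (a + b ∸ n))      ≡⟨ cong (n + n ∸_) (m+[n∸m]≡n n≤s) ⟩
    n + n ∸ (a + b)                ≡⟨ m≤n⇒m⊓n≡m (≤-trans (∸-monoʳ-≤ (n + n) n≤s) (≤-reflexive (m+n∸n≡m n n))) ⟨
    (n + n ∸ (a + b)) ⊓ n          ∎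
  case-split (inj₂ s≤n) = begin
    n ∸ (a + b ∸ n)                ≡⟨ cong (n ∸_) (m≤n⇒m∸n≡0 s≤n) ⟩
    n                              ≡⟨ m≥n⇒m⊓n≡n (≤-trans (≤-reflexive (sym (m+n∸n≡m n n))) (∸-monoʳ-≤ (n + n) s≤n)) ⟨
    (n + n ∸ (a + b)) ⊓ n          ∎

complement-⇒ : ∀ n a b → n ∸ ((n ∸ a) + b) ⊓ n ≡ (n ∸ b) ∸ (n ∸ a)
complement-⇒ n a b = begin
  n ∸ ((n ∸ a) + b) ⊓ n     ≡⟨ m∸n⊓m≡m∸n n ((n ∸ a) + b) ⟩
  n ∸ ((n ∸ a) + b)         ≡⟨ cong (n ∸_) (+-comm (n ∸ a) b) ⟩
  n ∸ (b + (n ∸ a))         ≡⟨ ∸-+-assoc n b (n ∸ a) ⟨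
  (n ∸ b) ∸ (n ∸ a)         ∎
  where open ≡-Reasoning

-- Layered algebras and the values of the selector on them.

-- An algebra resembling 𝐒 n or 𝐒ω n.  The corank of k / n is n ∸ k, and that
-- of (k , b) is n ∸ k: elements of 𝐒ω n infinitely close to the least or the
-- greatest element have the same corank as it.
record Layered (A : Algebra ℓ₁ ℓ₂) (n : ℕ) : Set (ℓ₁ ⊔ ℓ₂) where
  open Algebra A hiding (_≤_)
  field
    corank        : Carrier → ℕ
    corank-cong   : ∀ {x y} → x ≈ y → corank x ≡ corank y
    corank-·      : ∀ x y → corank (x · y) ≡ (corank x + corank y) ⊓ n
    corank-⇒      : ∀ x y → corank (x ⇒ y) ≡ corank y ∸ corank x
    corank-⊤      : corank ⊤ ≡ 0
    corank≤       : ∀ x → corank x ≤ n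
    ⊥             : Carrier
    corank-⊥      : corank ⊥ ≡ n
    ⊥-zeroˡ       : ∀ x → ⊥ · x ≈ ⊥
    bottom        : ∀ {x y} → corank x ≡ n → corank y ≢ 0 → x · y ≈ ⊥
    infinitesimal : ∀ {x} → corank x ≡ 0 → (x ⇒ x · x) ⇒ x ≈ ⊤

module LayeredProperties {A : Algebra ℓ₁ ℓ₂} (isHoop : IsHoop A) {n}
                         (n≢0 : n ≢ 0) (layered : Layered A n) where
  open Algebra A hiding (_≤_)
  open HoopProperties isHoop
  open Layered layered

  corank-join : ∀ x y → corank ((x ⇒ y) ⇒ y) ≡ corank x ⊓ corank y
  corank-join x y = begin
    corank ((x ⇒ y) ⇒ y)                ≡⟨ corank-⇒ (x ⇒ y) y ⟩
    corank y ∸ corank (x ⇒ y)           ≡⟨ cong (corank y ∸_) (corank-⇒ x y) ⟩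
    corank y ∸ (corank y ∸ corank x)    ≡⟨ m∸[m∸n]≡m⊓n (corank y) (corank x) ⟩
    corank y ⊓ corank x                 ≡⟨ ⊓-comm (corank y) (corank x) ⟩
    corank x ⊓ corank y                 ∎
    where open ≡-Reasoning

  corank-dist : ∀ x y → corank ((x ⇒ y) · (y ⇒ x)) ≡ ∣ corank x - corank y ∣
  corank-dist x y = begin
    corank ((x ⇒ y) · (y ⇒ x))                  ≡⟨ corank-· _ _ ⟩
    (corank (x ⇒ y) + corank (y ⇒ x)) ⊓ n       ≡⟨ cong (_⊓ n) (cong₂ _+_ (corank-⇒ x y) (corank-⇒ y x)) ⟩
    ((d ∸ c) + (c ∸ d)) ⊓ n                     ≡⟨ cong (_⊓ n) ([m∸n]+[n∸m]≡∣m-n∣ d c) ⟩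
    ∣ d - c ∣ ⊓ n                               ≡⟨ m≤n⇒m⊓n≡m (≤-trans (∣m-n∣≤m⊔n d c) (⊔-lub (corank≤ y) (corank≤ x))) ⟩
    ∣ d - c ∣                                   ≡⟨ ∣-∣-comm d c ⟩
    ∣ c - d ∣                                   ∎
    where
    open ≡-Reasoning
    c d : ℕ
    c = corank x
    d = corank y

  corank-^ᵗ : ∀ (s : Term X) k ρ →
              corank (⟦_⟧ A (s ^ᵗ k) ρ) ≡ (k * corank (⟦_⟧ A s ρ)) ⊓ n
  corank-^ᵗ s zero    ρ = corank-⊤
  corank-^ᵗ s (suc k) ρ = begin
    corank (⟦_⟧ A (s ^ᵗ k) ρ · x)          ≡⟨ corank-· _ x ⟩
    (corank (⟦_⟧ A (s ^ᵗ k) ρ) + c) ⊓ n    ≡⟨ cong (λ m → (m + c) ⊓ n) (corank-^ᵗ s k ρ) ⟩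
    ((k * c) ⊓ n + c) ⊓ n                  ≡⟨ cong (_⊓ n) (+-distribʳ-⊓ c (k * c) n) ⟩
    ((k * c + c) ⊓ (n + c)) ⊓ n            ≡⟨ ⊓-assoc (k * c + c) (n + c) n ⟩
    (k * c + c) ⊓ ((n + c) ⊓ n)            ≡⟨ cong₂ _⊓_ (+-comm (k * c) c) (m≥n⇒m⊓n≡n (m≤m+n n c)) ⟩
    (c + k * c) ⊓ n                        ∎
    where
    open ≡-Reasoning
    x = ⟦_⟧ A s ρ
    c = corank x

  -- A step preserves the gcd, and it lowers the sum of two nonzero coranks because the maximum is
  -- smaller than the sum.
  corank-euclid : ∀ N (s t : Term X) ρ →
                  corank (⟦_⟧ A s ρ) + corank (⟦_⟧ A t ρ) ≤ N →
                  corank (⟦_⟧ A (euclid N s t) ρ) ≡ gcd (corank (⟦_⟧ A s ρ)) (corank (⟦_⟧ A t ρ))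
  corank-euclid {X} N s t ρ bound = go N s t (inj₁ bound)
    where
    open ≡-Reasoning
    cr : Term X → ℕ
    cr r = corank (⟦_⟧ A r ρ)
    -- Once the minimum is 0, the first component is the answer and remains so.
    go : ∀ N s t → cr s + cr t ≤ N ⊎ cr t ≡ 0 → cr (euclid N s t) ≡ gcd (cr s) (cr t)
    go zero s t p = begin
      cr s                ≡⟨ gcd-identityʳ (cr s) ⟨
      gcd (cr s) 0        ≡⟨ cong (gcd (cr s)) ([ (λ q → m+n≡0⇒n≡0 (cr s) (n≤0⇒n≡0 q)) , id ]′ p) ⟨
      gcd (cr s) (cr t)   ∎
    go (suc N) s t p = begin
      cr (euclid N (dist s t) (join s t))          ≡⟨ go N (dist s t) (join s t) (next p) ⟩
      gcd (cr (dist s t)) (cr (join s t))          ≡⟨ cong₂ gcd (corank-dist _ _) (corank-join _ _) ⟩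
      gcd ∣ cr s - cr t ∣ (cr s ⊓ cr t)            ≡⟨ gcd-∣-∣-⊓ (cr s) (cr t) ⟩
      gcd (cr s) (cr t)                            ∎
      where
      sum≡ : cr (dist s t) + cr (join s t) ≡ cr s ℕ.⊔ cr t
      sum≡ = trans (cong₂ _+_ (corank-dist _ _) (corank-join _ _)) (∣m-n∣+m⊓n≡m⊔n (cr s) (cr t))
      shrink : ∀ a b → a + b ≤ suc N → (a ℕ.⊔ b ≤ N) ⊎ a ⊓ b ≡ 0
      shrink zero    b       _       = inj₂ refl
      shrink (suc a) zero    _       = inj₂ refl
      shrink (suc a) (suc b) (s≤s q) = inj₁ (⊔-lub
        (≤-trans (≤-trans (s≤s (m≤m+n a b)) (≤-reflexive (sym (+-suc a b)))) q)
        (≤-trans (m≤n+m (suc b) a) q))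
      next : cr s + cr t ≤ suc N ⊎ cr t ≡ 0 →
             cr (dist s t) + cr (join s t) ≤ N ⊎ cr (join s t) ≡ 0
      next (inj₁ q) with shrink (cr s) (cr t) q
      ... | inj₁ r = inj₁ (≤-trans (≤-reflexive sum≡) r)
      ... | inj₂ r = inj₂ (trans (corank-join _ _) r)
      next (inj₂ q) = inj₂ (trans (corank-join _ _) (trans (cong (cr s ⊓_) q) (⊓-zeroʳ (cr s))))

  corank-quotientTest : ∀ (b s : Term X) k ρ →
    corank (⟦_⟧ A b ρ) ≡ n →
    let y = corank (⟦_⟧ A s ρ) in
    corank (⟦_⟧ A (quotientTest b s k) ρ) ≡ ∣ (n ∸ k * y) - y ∣
  corank-quotientTest b s k ρ b≡n = begin
    corank (⟦_⟧ A (quotientTest b s k) ρ)               ≡⟨ corank-dist _ _ ⟩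
    ∣ corank (⟦_⟧ A (s ^ᵗ k) ρ ⇒ ⟦_⟧ A b ρ) - y ∣       ≡⟨ cong (λ m → ∣ m - y ∣) (corank-⇒ _ _) ⟩
    ∣ (corank (⟦_⟧ A b ρ) ∸ corank (⟦_⟧ A (s ^ᵗ k) ρ)) - y ∣
      ≡⟨ cong₂ (λ m m′ → ∣ (m ∸ m′) - y ∣) b≡n (corank-^ᵗ s k ρ) ⟩
    ∣ (n ∸ (k * y) ⊓ n) - y ∣                           ≡⟨ cong (λ m → ∣ m - y ∣) (m∸n⊓m≡m∸n n (k * y)) ⟩
    ∣ (n ∸ k * y) - y ∣                                 ∎
    where
    open ≡-Reasoning
    y = corank (⟦_⟧ A s ρ)

  module _ (b s : Term X) (ρ : X → Carrier) (b≡n : corank (⟦_⟧ A b ρ) ≡ n) where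
    private
      y : ℕ
      y = corank (⟦_⟧ A s ρ)
      test : ℕ → ℕ
      test k = corank (⟦_⟧ A (quotientTest b s k) ρ)
      rest : List ℕ → ℕ
      rest D = corank (⟦_⟧ A (someQuotient b s D) ρ)

    someQuotient-⊤ : ∀ {k D} → k ∈ D → suc k * y ≡ n →
                     corank (⟦_⟧ A (someQuotient b s D) ρ) ≡ 0
    someQuotient-⊤ {k} {_ ∷ D} (here refl) eq = trans (corank-join _ _)
      (cong (_⊓ rest D) (trans (corank-quotientTest b s k ρ b≡n) (m≡n⇒∣m-n∣≡0 (begin
        n ∸ k * y             ≡⟨ cong (_∸ k * y) eq ⟨
        y + k * y ∸ k * y     ≡⟨ m+n∸n≡m y (k * y) ⟩
        y                     ∎))))
      where open ≡-Reasoning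
    someQuotient-⊤ {D = k ∷ _} (there k∈D) eq = trans (corank-join _ _)
      (trans (cong (test k ⊓_) (someQuotient-⊤ k∈D eq)) (⊓-zeroʳ (test k)))

    someQuotient-⊤⁻¹ : y ≢ 0 → ∀ D →
                       corank (⟦_⟧ A (someQuotient b s D) ρ) ≡ 0 →
                       ∃[ k ] k ∈ D × suc k * y ≡ n
    someQuotient-⊤⁻¹ y≢0 []      eq = contradiction (trans (sym b≡n) eq) n≢0
    someQuotient-⊤⁻¹ y≢0 (k ∷ D) eq
      with ⊓-sel (test k) (rest D)
    ... | inj₁ first = k , here refl , (begin
      y + k * y             ≡⟨ cong (_+ k * y) gap ⟨
      -- As `gap` equates the difference with y ≠ 0, the subtraction was not truncated and can be
      -- undone.
      n ∸ k * y + k * y     ≡⟨ m∸n+n≡m (<⇒≤ (m∸n≢0⇒n<m {n} {k * y} (y≢0 ∘ trans (sym gap)))) ⟩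
      n                     ∎)
      where
      open ≡-Reasoning
      gap : n ∸ k * y ≡ y
      gap = ∣m-n∣≡0⇒m≡n (trans (sym (corank-quotientTest b s k ρ b≡n))
               (trans (sym first) (trans (sym (corank-join _ _)) eq)))
    ... | inj₂ later with someQuotient-⊤⁻¹ y≢0 D
                            (trans (sym later) (trans (sym (corank-join _ _)) eq))
    ...   | k′ , k′∈D , eq′ = k′ , there k′∈D , eq′

  boolean-⊤ : ∀ N (s : Term X) ρ → corank (⟦_⟧ A s ρ) ≡ 0 → ⟦_⟧ A (boolean N s) ρ ≈ ⊤
  boolean-⊤ N s ρ s≡0 = ≈-trans (⟦boolean⟧ N s ρ) (infinitesimal (trans (corank-^ᵗ s N ρ)
    (cong (_⊓ n) (trans (cong (N *_) s≡0) (*-zeroʳ N)))))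

  -- The power N reaches corank n, which in `𝐒ω n` does not yet mean ⊥. One more factor of nonzero
  -- corank reaches ⊥ by `bottom`, hence the exponent `suc N`.
  ^ᵗ-⊥ : ∀ {N} → n ≤ N → ∀ (s : Term X) ρ → corank (⟦_⟧ A s ρ) ≢ 0 →
         ⟦_⟧ A (s ^ᵗ suc N) ρ ≈ ⊥
  ^ᵗ-⊥ {N = N} n≤N s ρ s≢0 = bottom (trans (corank-^ᵗ s N ρ) (m≥n⇒m⊓n≡n
    (≤-trans n≤N (m≤m*n N _ {{≢-nonZero s≢0}})))) s≢0

  boolean-⊥ : ∀ {N} → n ≤ N → ∀ (s : Term X) ρ → corank (⟦_⟧ A s ρ) ≢ 0 →
              ⟦_⟧ A (boolean (suc N) s) ρ ≈ ⊥
  boolean-⊥ {N = N} n≤N s ρ s≢0 = begin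
    ⟦_⟧ A (boolean (suc N) s) ρ    ≈⟨ ⟦boolean⟧ (suc N) s ρ ⟩
    (v ⇒ v · v) ⇒ v                ≈⟨ ⇒-cong (⇒-cong v≈⊥ (·-cong v≈⊥ v≈⊥)) v≈⊥ ⟩
    (⊥ ⇒ ⊥ · ⊥) ⇒ ⊥                ≈⟨ ⇒-cong (⇒-cong ≈-refl (⊥-zeroˡ ⊥)) ≈-refl ⟩
    (⊥ ⇒ ⊥) ⇒ ⊥                    ≈⟨ ⇒-cong (⇒-self ⊥) ≈-refl ⟩
    ⊤ ⇒ ⊥                          ≈⟨ ⊤-⇒-identityˡ ⊥ ⟩
    ⊥                              ∎
    where
    open SetoidReasoning setoid
    v = ⟦_⟧ A (s ^ᵗ suc N) ρ
    v≈⊥ = ^ᵗ-⊥ n≤N s ρ s≢0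

  ⊥-zeroʳ : ∀ x → x · ⊥ ≈ ⊥
  ⊥-zeroʳ x = ≈-trans (comm x ⊥) (⊥-zeroˡ x)

  module _ {N} (n+n≤N : n + n ≤ N) (D : List ℕ) (ρ : Fin 1 → Carrier) where
    private
      x = ρ zero
      c = corank x
      b : UnaryTerm
      b = boolean (suc N) 𝕩
      q : UnaryTerm
      q = someQuotient b (euclid (suc N) 𝕩 b) D
      n≤N : n ≤ N
      n≤N = ≤-trans (m≤m+n n n) n+n≤N

    selector-infinitesimal : c ≡ 0 → ⟦_⟧ A (selector (suc N) D) ρ ≈ x
    selector-infinitesimal c≡0 =
      ≈-trans (·-cong ≈-refl (join-⊤ˡ (boolean-⊤ (suc N) 𝕩 ρ c≡0))) (identityʳ x)

    module _ (c≢0 : c ≢ 0) where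
      private
        b≈⊥ : ⟦_⟧ A b ρ ≈ ⊥
        b≈⊥ = boolean-⊥ n≤N 𝕩 ρ c≢0
        b≡n : corank (⟦_⟧ A b ρ) ≡ n
        b≡n = trans (corank-cong b≈⊥) corank-⊥
        -- `euclid` starts from the coranks c ≤ n and n, whence the bound n + n ≤ N.
        y≡gcd : corank (⟦_⟧ A (euclid (suc N) 𝕩 b) ρ) ≡ gcd c n
        y≡gcd = trans (corank-euclid (suc N) 𝕩 b ρ (≤-trans
          (+-mono-≤ (corank≤ x) (≤-reflexive b≡n)) (≤-trans n+n≤N (n≤1+n N))))
          (cong (gcd c) b≡n)

      selector-𝕩 : ∀ {k} → k ∈ D → suc k * gcd c n ≡ n →
                   ⟦_⟧ A (selector (suc N) D) ρ ≈ x
      selector-𝕩 {k} k∈D eq = ≈-trans (·-cong ≈-refl (join-⊤ʳ (boolean-⊤ (suc N) q ρ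
        (someQuotient-⊤ b _ ρ b≡n k∈D (trans (cong (suc k *_) y≡gcd) eq))))) (identityʳ x)

      selector-⊥ : (∀ {k} → k ∈ D → suc k * gcd c n ≢ n) →
                   ⟦_⟧ A (selector (suc N) D) ρ ≈ ⊥
      selector-⊥ none = ≈-trans (·-cong ≈-refl (≈-trans (join-idem (≈-trans b≈⊥ (≈-sym q≈⊥))) q≈⊥))
                                (⊥-zeroʳ x)
        where
        q≢0 : corank (⟦_⟧ A q ρ) ≢ 0
        q≢0 eq with someQuotient-⊤⁻¹ b _ ρ b≡n
                      (λ y≡0 → c≢0 (gcd[m,n]≡0⇒m≡0 (trans (sym y≡gcd) y≡0))) D eq
        ... | k , k∈D , eq′ = none k∈D (trans (cong (suc k *_) (sym y≡gcd)) eq′)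
        q≈⊥ : ⟦_⟧ A (boolean (suc N) q) ρ ≈ ⊥
        q≈⊥ = boolean-⊥ n≤N q ρ q≢0

-- The finite chains `𝐒 n` as layered algebras.

module 𝐒-layers (n : ℕ) where
  open 𝐒-operations n

  corank : Fin (suc n) → ℕ
  corank k = n ∸ toℕ k

  corank-injective : ∀ {k l} → corank k ≡ corank l → k ≡ l
  corank-injective {k} {l} eq = Fin.toℕ-injective (∸-cancelˡ-≡ (bound k) (bound l) eq)

  corank-· : ∀ k l → corank (k · l) ≡ (corank k + corank l) ⊓ n
  corank-· k l = trans (cong (n ∸_) (toℕ-· k l)) (complement-⊙ (bound k) (bound l))

  corank-⇒ : ∀ k l → corank (k ⇒ l) ≡ corank l ∸ corank k
  corank-⇒ k l = begin
    n ∸ toℕ (k ⇒ l)                       ≡⟨ cong (n ∸_) (toℕ-⇒ k l) ⟩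
    n ∸ (n + toℕ l ∸ toℕ k) ⊓ n           ≡⟨ cong (λ m → n ∸ m ⊓ n) (+-∸-comm (toℕ l) (bound k)) ⟩
    n ∸ ((n ∸ toℕ k) + toℕ l) ⊓ n         ≡⟨ complement-⇒ n (toℕ k) (toℕ l) ⟩
    corank l ∸ corank k                   ∎
    where open ≡-Reasoning

  corank-⊤ : corank ⊤ ≡ 0
  corank-⊤ = trans (cong (n ∸_) (Fin.toℕ-fromℕ n)) (n∸n≡0 n)

  layered : Layered (WajsbergHoop.algebra wajsbergHoop) n
  layered = record
    { corank        = corank
    ; corank-cong   = cong corank
    ; corank-·      = corank-·
    ; corank-⇒      = corank-⇒
    ; corank-⊤      = corank-⊤
    ; corank≤       = λ k → m∸n≤m n (toℕ k)
    ; ⊥             = zero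
    ; corank-⊥      = refl
    ; ⊥-zeroˡ       = λ k → corank-injective (trans (corank-· zero k) (n+m⊓n≡n (corank k)))
    ; bottom        = λ {k} {l} k≡n _ → corank-injective (trans (corank-· k l)
        (trans (cong (λ m → (m + corank l) ⊓ n) k≡n) (n+m⊓n≡n (corank l))))
    ; infinitesimal = λ {k} k≡0 → corank-injective (trans (corank-⇒ (k ⇒ k · k) k)
        (trans (trans (cong (_∸ corank (k ⇒ k · k)) k≡0) (0∸n≡0 (corank (k ⇒ k · k))))
          (sym corank-⊤)))
    }
    where
    n+m⊓n≡n : ∀ m → (n + m) ⊓ n ≡ n
    n+m⊓n≡n m = m≥n⇒m⊓n≡n (m≤m+n n m)

-- The chains `𝐒ω n` as layered algebras.

module 𝐒ω-layers {n : ℕ} (n≢0 : n ≢ 0) where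
  open 𝐒ω-operations n
  open AbelianGroup ℤ²-abelianGroup
    renaming (Carrier to ℤ²; _≈_ to _≈²_; _∙_ to _+²_; _⁻¹ to -²_
             ; refl to ≈-refl; sym to ≈-sym; trans to ≈-trans)
  open TotalOrder ℤ²-lexicographic using ()
    renaming (_≤_ to _≤²_; total to ≤²-total; ≤-respʳ-≈ to ≤²-respʳ)
  open NaturalMin ℤ²-lexicographic using (x⊓y≤x)
    renaming (_⊓_ to min²; x≤y⇒x⊓y≈x to min-≤; x≤y⇒y⊓x≈x to min-≥)
  open AbelianGroupProperties ℤ²-abelianGroup using (//-rightDividesˡ; ⁻¹-∙-comm)

  ≤²-proj₁ : ∀ {x y} → x ≤² y → proj₁ x ℤ.≤ proj₁ y
  ≤²-proj₁ (inj₁ (x₁≤y₁ , _)) = x₁≤y₁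
  ≤²-proj₁ (inj₂ (x₁≡y₁ , _)) = ℤ.≤-reflexive x₁≡y₁

  <-≤² : ∀ {x y} → proj₁ x ℤ.< proj₁ y → x ≤² y
  <-≤² x₁<y₁ = inj₁ (ℤ.<⇒≤ x₁<y₁ , ℤ.<⇒≢ x₁<y₁)

  rank : Universe → ℕ
  rank ((x₁ , _) , _) = ℤ.∣ x₁ ∣

  +rank : ∀ x → ℤ.+ rank x ≡ proj₁ (proj₁ x)
  +rank (_ , 0≤x , _) = ℤ.0≤i⇒+∣i∣≡i (≤²-proj₁ 0≤x)

  rank≤ : ∀ x → rank x ≤ n
  rank≤ x@(_ , _ , x≤u) =
    ℤ.drop‿+≤+ (ℤ.≤-trans (ℤ.≤-reflexive (+rank x)) (≤²-proj₁ x≤u))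

  rank-¬ : ∀ x → rank (¬′ x) ≡ n ∸ rank x
  rank-¬ x = cong ℤ.∣_∣ (begin
    ℤ.+ n ℤ.+ ℤ.- proj₁ (proj₁ x)    ≡⟨ cong (λ z → ℤ.+ n ℤ.+ ℤ.- z) (+rank x) ⟨
    ℤ.+ n ℤ.+ ℤ.- (ℤ.+ rank x)       ≡⟨ ℤ.[+m]-[+n]≡m⊖n n (rank x) ⟩
    n ℤ.⊖ rank x                     ≡⟨ ℤ.⊖-≥ (rank≤ x) ⟩
    ℤ.+ (n ∸ rank x)                 ∎)
    where open ≡-Reasoning

  rank-+² : ∀ x y → proj₁ (proj₁ x +² proj₁ y) ≡ ℤ.+ (rank x + rank y)
  rank-+² x y = sym (cong₂ ℤ._+_ (+rank x) (+rank y))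

  -- The first projection is monotone for the lexicographic order, so it commutes with taking the
  -- minimum with `u`.
  rank-⊕ : ∀ x y → rank (x ⊕ y) ≡ (rank x + rank y) ⊓ n
  rank-⊕ x y = cong ℤ.∣_∣ (case-split (≤²-total s u))
    where
    s = proj₁ x +² proj₁ y
    s₁≡ = rank-+² x y
    case-split : s ≤² u ⊎ u ≤² s → proj₁ (min² s u) ≡ ℤ.+ ((rank x + rank y) ⊓ n)
    case-split (inj₁ s≤u) = trans (proj₁ (min-≤ s≤u)) (trans s₁≡ (cong ℤ.+_ (sym (m≤n⇒m⊓n≡m
      (ℤ.drop‿+≤+ (ℤ.≤-trans (ℤ.≤-reflexive (sym s₁≡)) (≤²-proj₁ s≤u)))))))
    case-split (inj₂ u≤s) = trans (proj₁ (min-≥ u≤s)) (cong ℤ.+_ (sym (m≥n⇒m⊓n≡n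
      (ℤ.drop‿+≤+ (ℤ.≤-trans (≤²-proj₁ u≤s) (ℤ.≤-reflexive s₁≡))))))

  corank : Universe → ℕ
  corank x = n ∸ rank x

  corank-· : ∀ x y → corank (x · y) ≡ (corank x + corank y) ⊓ n
  corank-· x y = begin
    n ∸ rank (¬′ (¬′ x ⊕ ¬′ y))         ≡⟨ cong (n ∸_) (rank-¬ (¬′ x ⊕ ¬′ y)) ⟩
    n ∸ (n ∸ rank (¬′ x ⊕ ¬′ y))        ≡⟨ m∸[m∸n]≡n (rank≤ (¬′ x ⊕ ¬′ y)) ⟩
    rank (¬′ x ⊕ ¬′ y)                  ≡⟨ rank-⊕ (¬′ x) (¬′ y) ⟩
    (rank (¬′ x) + rank (¬′ y)) ⊓ n     ≡⟨ cong₂ (λ a b → (a + b) ⊓ n) (rank-¬ x) (rank-¬ y) ⟩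
    (corank x + corank y) ⊓ n           ∎
    where open ≡-Reasoning

  corank-⇒ : ∀ x y → corank (x ⇒ y) ≡ corank y ∸ corank x
  corank-⇒ x y = begin
    n ∸ rank (¬′ x ⊕ y)                 ≡⟨ cong (n ∸_) (rank-⊕ (¬′ x) y) ⟩
    n ∸ (rank (¬′ x) + rank y) ⊓ n      ≡⟨ cong (λ a → n ∸ (a + rank y) ⊓ n) (rank-¬ x) ⟩
    n ∸ ((n ∸ rank x) + rank y) ⊓ n     ≡⟨ complement-⇒ n (rank x) (rank y) ⟩
    corank y ∸ corank x                 ∎
    where open ≡-Reasoning

  u≤¬+¬⇒·≈0 : ∀ x y → u ≤² proj₁ (¬′ x) +² proj₁ (¬′ y) → x · y ≈ 0′
  u≤¬+¬⇒·≈0 x y u≤s =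
    ≈-trans (¬-cong {¬′ x ⊕ ¬′ y} {⊤} (min-≥ u≤s)) (inverseʳ u)

  ⊥-zeroˡ : ∀ x → 0′ · x ≈ 0′
  ⊥-zeroˡ x = u≤¬+¬⇒·≈0 0′ x (≤²-respʳ (∙-congʳ {proj₁ (¬′ x)} (≈-sym (⊕-neg)))
    (≤-+ʳ u (proj₁ (proj₂ (¬′ x)))))
    where
    ⊕-neg : proj₁ (¬′ 0′) ≈² u
    ⊕-neg = ℤ.+-identityʳ _ , refl

  -- The first coordinates of the negations add up to n + corank y > n, so they alone decide the
  -- comparison with `u`, whatever the infinitesimal parts.
  bottom : ∀ {x y} → corank x ≡ n → corank y ≢ 0 → x · y ≈ 0′
  bottom {x} {y} x≡n y≢0 = u≤¬+¬⇒·≈0 x y (<-≤² (ℤ.<-≤-trans (ℤ.+<+ n<sum)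
    (ℤ.≤-reflexive (sym (rank-+² (¬′ x) (¬′ y))))))
    where
    n<sum : n < rank (¬′ x) + rank (¬′ y)
    n<sum = ≤-trans (m<m+n n (n≢0⇒n>0 y≢0))
      (≤-reflexive (sym (cong₂ _+_ (trans (rank-¬ x) x≡n) (rank-¬ y))))

  -- The negation w of x has first coordinate 0, so w + w stays below `u` and x · x is u - 2w
  -- without truncation. Hence x ⇒ x · x lies below w + (u - 2w) = x.
  infinitesimal : ∀ {x} → corank x ≡ 0 → (x ⇒ x · x) ⇒ x ≈ ⊤
  infinitesimal {x} x≡0 = ⇒-top (x ⇒ x · x) x
    (≤²-respʳ cancel (x⊓y≤x (w +² proj₁ (x · x)) u))
    where
    open SetoidReasoning setoid
    w : ℤ²
    w = proj₁ (¬′ x)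
    w+w≤u : w +² w ≤² u
    w+w≤u = <-≤² (ℤ.≤-<-trans (ℤ.≤-reflexive (trans (rank-+² (¬′ x) (¬′ x))
      (cong (λ a → ℤ.+ (a + a)) (trans (rank-¬ x) x≡0)))) (ℤ.+<+ (n≢0⇒n>0 n≢0)))
    cancel : w +² proj₁ (x · x) ≈² proj₁ x
    cancel = begin
      w +² (u +² -² min² (w +² w) u)    ≈⟨ ∙-congˡ {w} (∙-congˡ {u} (⁻¹-cong (min-≤ w+w≤u))) ⟩
      w +² (u +² -² (w +² w))           ≈⟨ comm w (u +² -² (w +² w)) ⟩
      (u +² -² (w +² w)) +² w           ≈⟨ assoc u (-² (w +² w)) w ⟩
      u +² (-² (w +² w) +² w)           ≈⟨ ∙-congˡ {u} (∙-congʳ {w} (⁻¹-∙-comm w w)) ⟨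
      u +² ((-² w +² -² w) +² w)        ≈⟨ ∙-congˡ {u} (//-rightDividesˡ w (-² w)) ⟩
      u +² -² w                         ≈⟨ ¬-involutive x ⟩
      proj₁ x                           ∎

  layered : Layered (WajsbergHoop.algebra wajsbergHoop) n
  layered = record
    { corank        = corank
    ; corank-cong   = λ x≈y → cong (λ z → n ∸ ℤ.∣ z ∣) (proj₁ x≈y)
    ; corank-·      = corank-·
    ; corank-⇒      = corank-⇒
    ; corank-⊤      = n∸n≡0 n
    ; corank≤       = λ x → m∸n≤m n (rank x)
    ; ⊥             = 0′
    ; corank-⊥      = refl
    ; ⊥-zeroˡ       = ⊥-zeroˡ
    ; bottom        = λ {x} {y} → bottom {x} {y}
    ; infinitesimal = λ {x} → infinitesimal {x}
    }

-- Transfer of conuclei from generators to the variety.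

ConucleusIdentities : (A : Algebra ℓ₁ ℓ₂) → (Algebra.Carrier A → Algebra.Carrier A) →
                      Set (ℓ₁ ⊔ ℓ₂)
ConucleusIdentities A δ =
  (∀ x → δ x ≤ᴬ x) × (∀ x → δ (δ x) ≈ δ x) × (∀ x y → δ (x · y) ≈ δ x · δ y)
  where open Algebra A renaming (_≤_ to _≤ᴬ_)

module _ {𝒦 : Pred (WajsbergHoop 0ℓ 0ℓ) κ} where

  -- Membership in `V 𝒦` is instantiated at a singleton set of identities.
  V-⊨ : ∀ {A : Algebra ℓ₁ ℓ₂} → V 𝒦 A → ∀ s t →
        (∀ B → 𝒦 B → _⊨_≈ᵗ_ (WajsbergHoop.algebra B) s t) → _⊨_≈ᵗ_ A s t
  V-⊨ A∈V s t valid = A∈V (_≡ (s , t)) (λ { B B∈𝒦 _ _ refl → valid B B∈𝒦 }) s t refl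

  -- On hoops x ≤ y gives x = y · (y ⇒ x), so a multiplicative deflationary
  -- operation is monotone; all properties required are then identities.
  conucleus-on-V : ∀ t →
    (∀ B → 𝒦 B → ConucleusIdentities (WajsbergHoop.algebra B) (unaryOp (WajsbergHoop.algebra B) t)) →
    t isMultiplicativeConucleusOn V {c = ℓ₁} {ℓ = ℓ₂} 𝒦
  conucleus-on-V t hyp A A∈V = record
    { isInteriorOperator = record
      { δ-cong       = δ-cong
      ; deflationary = deflationary
      ; monotone     = monotone
      ; idempotent   = idempotent
      }
    ; multiplicative = multiplicative
    }
    where
    open Algebra A renaming (_≤_ to _≤ᴬ_)
    open IsEquivalence isEquivalence
      renaming (refl to ≈-refl; sym to ≈-sym; trans to ≈-trans; reflexive to ≈-reflexive)

    setoid : Setoid _ _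
    setoid = record { isEquivalence = isEquivalence }

    open SetoidReasoning setoid

    δ : Carrier → Carrier
    δ = unaryOp A t

    x₀ x₁ : Term ℕ
    x₀ = var 0
    x₁ = var 1

    -- Identities have variables in ℕ, `t` has its variable in `Fin 1`; substitution moves `t`
    -- across and also expresses iteration.
    apply : Term ℕ → Term ℕ
    apply s = substitute (λ _ → s) t

    ⟦apply⟧ : ∀ {c ℓ} (B : Algebra c ℓ) s ρ → ⟦_⟧ B (apply s) ρ ≡ unaryOp B t (⟦_⟧ B s ρ)
    ⟦apply⟧ B s ρ = ⟦⟧-substitute B t (λ _ → s) ρ

    assign : Carrier → Carrier → ℕ → Carrier
    assign a b zero    = a
    assign a b (suc _) = b

    δ-cong : ∀ {a b} → a ≈ b → δ a ≈ δ b
    δ-cong a≈b = ⟦⟧-cong A t (λ _ → a≈b)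

    deflationary-𝒦 : ∀ B → 𝒦 B → _⊨_≈ᵗ_ (WajsbergHoop.algebra B) (apply x₀ ⇒ᵗ x₀) ⊤ᵗ
    deflationary-𝒦 B B∈𝒦 ρ rewrite ⟦apply⟧ (WajsbergHoop.algebra B) x₀ ρ =
      proj₁ (hyp B B∈𝒦) _

    deflationary : ∀ a → δ a ≤ᴬ a
    deflationary a = ≈-trans
      (⇒-cong (≈-reflexive (sym (⟦apply⟧ A x₀ (assign a a)))) ≈-refl)
      (V-⊨ {A = A} A∈V (apply x₀ ⇒ᵗ x₀) ⊤ᵗ deflationary-𝒦 (assign a a))

    idempotent-𝒦 : ∀ B → 𝒦 B →
                   _⊨_≈ᵗ_ (WajsbergHoop.algebra B) (apply (apply x₀)) (apply x₀)
    idempotent-𝒦 B B∈𝒦 ρ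
      rewrite ⟦apply⟧ (WajsbergHoop.algebra B) (apply x₀) ρ
            | ⟦apply⟧ (WajsbergHoop.algebra B) x₀ ρ =
      proj₁ (proj₂ (hyp B B∈𝒦)) _

    idempotent : ∀ a → δ (δ a) ≈ δ a
    idempotent a = begin
      δ (δ a)                                  ≈⟨ δ-cong (≈-reflexive (⟦apply⟧ A x₀ (assign a a))) ⟨
      δ (⟦_⟧ A (apply x₀) (assign a a))        ≈⟨ ≈-reflexive (⟦apply⟧ A (apply x₀) (assign a a)) ⟨
      ⟦_⟧ A (apply (apply x₀)) (assign a a)    ≈⟨ V-⊨ {A = A} A∈V (apply (apply x₀)) (apply x₀) idempotent-𝒦 (assign a a) ⟩
      ⟦_⟧ A (apply x₀) (assign a a)            ≈⟨ ≈-reflexive (⟦apply⟧ A x₀ (assign a a)) ⟩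
      δ a                                      ∎

    multiplicative-𝒦 : ∀ B → 𝒦 B →
      _⊨_≈ᵗ_ (WajsbergHoop.algebra B) (apply (x₀ ·ᵗ x₁)) (apply x₀ ·ᵗ apply x₁)
    multiplicative-𝒦 B B∈𝒦 ρ
      rewrite ⟦apply⟧ (WajsbergHoop.algebra B) (x₀ ·ᵗ x₁) ρ
            | ⟦apply⟧ (WajsbergHoop.algebra B) x₀ ρ
            | ⟦apply⟧ (WajsbergHoop.algebra B) x₁ ρ =
      proj₂ (proj₂ (hyp B B∈𝒦)) _ _

    multiplicative : ∀ a b → δ (a · b) ≈ δ a · δ b
    multiplicative a b = begin
      δ (a · b)
        ≈⟨ ≈-reflexive (⟦apply⟧ A (x₀ ·ᵗ x₁) (assign a b)) ⟨
      ⟦_⟧ A (apply (x₀ ·ᵗ x₁)) (assign a b)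
        ≈⟨ V-⊨ {A = A} A∈V (apply (x₀ ·ᵗ x₁)) (apply x₀ ·ᵗ apply x₁) multiplicative-𝒦 (assign a b) ⟩
      ⟦_⟧ A (apply x₀) (assign a b) · ⟦_⟧ A (apply x₁) (assign a b)
        ≈⟨ ·-cong (≈-reflexive (⟦apply⟧ A x₀ (assign a b))) (≈-reflexive (⟦apply⟧ A x₁ (assign a b))) ⟩
      δ a · δ b
        ∎

    -- `A` is given only as a member of `V 𝒦`, so the hoop laws behind monotonicity are transferred
    -- as identities too.
    identityʳ : ∀ a → a · ⊤ ≈ a
    identityʳ a = V-⊨ {A = A} A∈V (x₀ ·ᵗ ⊤ᵗ) x₀
      (λ B _ ρ → HoopProperties.identityʳ (WajsbergHoop.isHoop B) _) (assign a a)

    divisible : ∀ a b → a · (a ⇒ b) ≈ b · (b ⇒ a)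
    divisible a b = V-⊨ {A = A} A∈V (x₀ ·ᵗ (x₀ ⇒ᵗ x₁)) (x₁ ·ᵗ (x₁ ⇒ᵗ x₀))
      (λ B _ ρ → IsHoop.divisible (WajsbergHoop.isHoop B) _ _) (assign a b)

    ·-lowerˡ : ∀ a b → a · b ≤ᴬ a
    ·-lowerˡ a b = V-⊨ {A = A} A∈V (x₀ ·ᵗ x₁ ⇒ᵗ x₀) ⊤ᵗ
      (λ B _ ρ → HoopProperties.·-lowerˡ (WajsbergHoop.isHoop B) _ _) (assign a b)

    monotone : ∀ {a b} → a ≤ᴬ b → δ a ≤ᴬ δ b
    monotone {a} {b} a≤b = begin
      δ a ⇒ δ b                        ≈⟨ ⇒-cong (δ-cong a≈) ≈-refl ⟩
      δ (b · (b ⇒ a)) ⇒ δ b            ≈⟨ ⇒-cong (multiplicative b (b ⇒ a)) ≈-refl ⟩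
      δ b · δ (b ⇒ a) ⇒ δ b            ≈⟨ ·-lowerˡ (δ b) (δ (b ⇒ a)) ⟩
      ⊤                                ∎
      where
      a≈ : a ≈ b · (b ⇒ a)
      a≈ = begin
        a                ≈⟨ identityʳ a ⟨
        a · ⊤            ≈⟨ ·-cong ≈-refl a≤b ⟨
        a · (a ⇒ b)      ≈⟨ divisible a b ⟩
        b · (b ⇒ a)      ∎

-- The separating term and reduced denominators.

-- By coprimality the second condition bites only at the quotient 1, which belongs to corank n. In
-- `𝐒 i` only ⊥ has that corank, and there x and ⊥ agree. In `𝐒ω j` there are further such elements,
-- to be fixed for j in J₁ and sent to ⊥ for j in J₂; as J₁ or J₂ is empty, the two demands do not
-- clash.
admissible? : ∀ Π k → Dec (Any (suc k ∣_) (Quadruple.I₁ Π ++ Quadruple.J₁ Π) ×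
                           ¬ Any (suc k ∣_) (Quadruple.J₂ Π))
admissible? Π k = any? (suc k ∣?_) _ ×-dec ¬? (any? (suc k ∣?_) _)

sizeBound : Quadruple → ℕ
sizeBound Π = max 0 ((I₁ ++ J₁) ++ (I₂ ++ J₂))
  where open Quadruple Π

fuel : Quadruple → ℕ
fuel Π = sizeBound Π + sizeBound Π

-- Each k in the list stands for the divisor k + 1.
divisors : Quadruple → List ℕ
divisors Π = filter (admissible? Π) (upTo (sizeBound Π))

-- Opaque, lest with-abstraction normalise the exponentially large term.
opaque
  separator : Quadruple → UnaryTerm
  separator Π = selector (suc (fuel Π)) (divisors Π)

  separator-lower : ∀ {A : Algebra ℓ₁ ℓ₂} → IsHoop A → ∀ Π ρ →
                    Algebra._≤_ A (⟦_⟧ A (separator Π) ρ) (ρ zero)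
  separator-lower isHoop Π ρ = HoopProperties.·-lowerˡ isHoop (ρ zero) _

-- Here k + 1 is the denominator of c / n in lowest terms.
cofactor : ∀ c {n} → n ≢ 0 → ∃[ k ] suc k * gcd c n ≡ n
cofactor c {n} n≢0 with gcd[m,n]∣n c n
... | divides zero    eq = contradiction eq n≢0
... | divides (suc k) eq = k , sym eq

-- Quotient 1 would make n a divisor of c, although 0 < c < n.
cofactor≢1 : ∀ {c n} k → c ≢ 0 → c < n → suc k * gcd c n ≡ n → suc k ≢ 1
cofactor≢1 {c} {n} k c≢0 c<n eq refl =
  <⇒≱ c<n (∣⇒≤ {{≢-nonZero c≢0}} (subst (_∣ c) (trans (sym (*-identityˡ _)) eq) (gcd[m,n]∣m c n)))

cofactor-∣ : ∀ {c n} k → suc k * gcd c n ≡ n → suc k ∣ n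
cofactor-∣ {c} {n} k eq = divides (gcd c n) (trans (sym eq) (*-comm (suc k) (gcd c n)))

-- Values of the separator on layered generators.

module _ {T : Triple} {Π : Quadruple} (reduced : IsReduced T)
         (separation : IsMultiplicativeSeparation T Π) where
  open Triple T
  open Quadruple Π
  open IsReduced reduced
  open IsMultiplicativeSeparation separation

  common-divisor : ∀ {d m n} → m ∈ I₁ ++ J₁ → n ∈ I₂ ++ J₂ → d ∣ m → d ∣ n → d ≡ 1
  common-divisor m∈ n∈ d∣m d∣n = ∣1⇒≡1 (subst (_ ∣_) (coprime m∈ n∈) (gcd-greatest d∣m d∣n))

  module _ (B : WajsbergHoop 0ℓ 0ℓ) {n} (n≢0 : n ≢ 0)
           (layered : Layered (WajsbergHoop.algebra B) n) where
    private
      A = WajsbergHoop.algebra B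
    open Algebra A using (_≈_)
    open Layered layered using (corank; ⊥)
    open LayeredProperties (WajsbergHoop.isHoop B) n≢0 layered

    module _ (n∈ : n ∈ (I₁ ++ J₁) ++ (I₂ ++ J₂)) where

      private
        n≤bound : n ≤ sizeBound Π
        n≤bound = All.lookup (xs≤max 0 ((I₁ ++ J₁) ++ (I₂ ++ J₂))) n∈
        enough : n + n ≤ fuel Π
        enough = +-mono-≤ n≤bound n≤bound

      opaque
        unfolding separator

        separator-infinitesimal : ∀ ρ → corank (ρ zero) ≡ 0 → ⟦_⟧ A (separator Π) ρ ≈ ρ zero
        separator-infinitesimal = selector-infinitesimal enough (divisors Π)

        separator-selected : ∀ ρ → corank (ρ zero) ≢ 0 → ∀ {k} → k ∈ divisors Π →
                             suc k * gcd (corank (ρ zero)) n ≡ n →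
                             ⟦_⟧ A (separator Π) ρ ≈ ρ zero
        separator-selected = selector-𝕩 enough (divisors Π)

        separator-rejected : ∀ ρ → corank (ρ zero) ≢ 0 →
                             (∀ {k} → k ∈ divisors Π → suc k * gcd (corank (ρ zero)) n ≢ n) →
                             ⟦_⟧ A (separator Π) ρ ≈ ⊥
        separator-rejected = selector-⊥ enough (divisors Π)

      -- The reduced denominator divides n, which itself lies in I₁ ∪ J₁ and below the size bound,
      -- so only divisibility into J₂ has to be excluded.
      separator-𝕩 : n ∈ I₁ ++ J₁ →
        ∀ ρ → (corank (ρ zero) ≢ 0 → ∀ k → suc k * gcd (corank (ρ zero)) n ≡ n → ¬ Any (suc k ∣_) J₂) →
        ⟦_⟧ A (separator Π) ρ ≈ ρ zero
      separator-𝕩 n∈₁ ρ avoids with corank (ρ zero) ≟ 0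
      ... | yes c≡0 = separator-infinitesimal ρ c≡0
      ... | no  c≢0 with cofactor (corank (ρ zero)) n≢0
      ...   | k , eq = separator-selected ρ c≢0
        (∈-filter⁺ (admissible? Π)
          (∈-upTo⁺ (≤-trans (∣⇒≤ {{≢-nonZero n≢0}} (cofactor-∣ {corank (ρ zero)} k eq)) n≤bound))
          (lose n∈₁ (cofactor-∣ {corank (ρ zero)} k eq) , avoids c≢0 k eq)) eq

      separator-⊥ : ∀ ρ → corank (ρ zero) ≢ 0 →
        (∀ k → suc k * gcd (corank (ρ zero)) n ≡ n → Any (suc k ∣_) (I₁ ++ J₁) → Any (suc k ∣_) J₂) →
        ⟦_⟧ A (separator Π) ρ ≈ ⊥
      separator-⊥ ρ c≢0 hits = separator-rejected ρ c≢0 λ {k} k∈ eq →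
        let (_ , any₁ , ¬any₂) = ∈-filter⁻ (admissible? Π) {xs = upTo (sizeBound Π)} k∈
        in ¬any₂ (hits k eq any₁)

  -- Conuclei that are the identity or collapse to the least element.

  Identical : WajsbergHoop 0ℓ 0ℓ → Set
  Identical B = B ⊨ separator Π ≈ 𝕩

  -- On `𝐒 i` this behaviour is that of xⁱ, on `𝐒ω j` that of the formula prescribed for J₂.
  record Collapsing (B : WajsbergHoop 0ℓ 0ℓ) : Set where
    open Algebra (WajsbergHoop.algebra B) hiding (_≤_)
    field
      {size}          : ℕ
      size≢0          : size ≢ 0
      layered         : Layered (WajsbergHoop.algebra B) size
    open Layered layered public
    field
      at-infinitesimal : ∀ ρ → corank (ρ zero) ≡ 0 → ⟦_⟧ (WajsbergHoop.algebra B) (separator Π) ρ ≈ ρ zero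
      elsewhere        : ∀ ρ → corank (ρ zero) ≢ 0 → ⟦_⟧ (WajsbergHoop.algebra B) (separator Π) ρ ≈ ⊥

  Conuclear : WajsbergHoop 0ℓ 0ℓ → Set
  Conuclear B = ConucleusIdentities A (unaryOp A (separator Π))
    where A = WajsbergHoop.algebra B

  identical⇒conuclear : ∀ {B} → Identical B → Conuclear B
  identical⇒conuclear {B} same =
      (λ x → separator-lower (WajsbergHoop.isHoop B) Π _)
    , (λ x → same _)
    , (λ x y → ≈-trans (same _) (≈-sym (·-cong (same _) (same _))))
    where
    open Algebra (WajsbergHoop.algebra B) hiding (_≤_)
    open HoopProperties (WajsbergHoop.isHoop B)

  -- Coranks add up to truncation, so a product has corank 0 exactly when both factors do. Fixing
  -- such elements and sending all others to the absorbing ⊥ is therefore multiplicative.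
  collapsing⇒conuclear : ∀ {B} → Collapsing B → Conuclear B
  collapsing⇒conuclear {B} collapsing =
      (λ x → separator-lower (WajsbergHoop.isHoop B) Π _)
    , idempotent
    , multiplicative
    where
    open Algebra (WajsbergHoop.algebra B) hiding (_≤_)
    open HoopProperties (WajsbergHoop.isHoop B)
    open Collapsing collapsing
    open LayeredProperties (WajsbergHoop.isHoop B) size≢0 layered using (⊥-zeroʳ)
    open SetoidReasoning setoid
    δ = unaryOp (WajsbergHoop.algebra B) (separator Π)

    δ-cong : ∀ {x y} → x ≈ y → δ x ≈ δ y
    δ-cong x≈y = ⟦⟧-cong (WajsbergHoop.algebra B) (separator Π) (λ _ → x≈y)

    ⊓size≡0 : ∀ {m} → m ⊓ size ≡ 0 → m ≡ 0
    ⊓size≡0 {m} eq with ⊓-sel m size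
    ... | inj₁ m⊓size≡m    = trans (sym m⊓size≡m) eq
    ... | inj₂ m⊓size≡size = contradiction (trans (sym m⊓size≡size) eq) size≢0

    idempotent : ∀ x → δ (δ x) ≈ δ x
    idempotent x with corank x ≟ 0
    ... | yes x≡0 = δ-cong (at-infinitesimal _ x≡0)
    ... | no  x≢0 = ≈-trans (δ-cong (elsewhere _ x≢0))
      (≈-trans (elsewhere _ (size≢0 ∘ trans (sym corank-⊥))) (≈-sym (elsewhere _ x≢0)))

    multiplicative : ∀ x y → δ (x · y) ≈ δ x · δ y
    multiplicative x y with corank x ≟ 0 | corank y ≟ 0
    ... | yes x≡0 | yes y≡0 = ≈-trans
      (at-infinitesimal _ (trans (corank-· x y) (cong (_⊓ size) (cong₂ _+_ x≡0 y≡0))))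
      (≈-sym (·-cong (at-infinitesimal _ x≡0) (at-infinitesimal _ y≡0)))
    ... | no x≢0 | _ = ≈-trans
      (elsewhere _ λ eq → x≢0 (m+n≡0⇒m≡0 _ (⊓size≡0 (trans (sym (corank-· x y)) eq))))
      (≈-sym (≈-trans (·-cong (elsewhere _ x≢0) ≈-refl) (⊥-zeroˡ _)))
    ... | yes _ | no y≢0 = ≈-trans
      (elsewhere _ λ eq → y≢0 (m+n≡0⇒n≡0 (corank x) (⊓size≡0 (trans (sym (corank-· x y)) eq))))
      (≈-sym (≈-trans (·-cong ≈-refl (elsewhere _ y≢0)) (⊥-zeroʳ _)))

  -- The factor `boolean (suc size) 𝕩` is ⊤ at corank 0 and ⊥ elsewhere; the exponent exceeds the
  -- size by one as in `^ᵗ-⊥`.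
  collapsing-formula : ∀ {B} (collapsing : Collapsing B) →
    B ⊨ separator Π ≈ 𝕩 ·ᵗ boolean (suc (Collapsing.size collapsing)) 𝕩
  collapsing-formula {B} collapsing ρ = cases (corank (ρ zero) ≟ 0)
    where
    open Algebra (WajsbergHoop.algebra B) using (_≈_; ·-cong)
    open HoopProperties (WajsbergHoop.isHoop B)
    open Collapsing collapsing
    open LayeredProperties (WajsbergHoop.isHoop B) size≢0 layered
    value : UnaryTerm → Algebra.Carrier (WajsbergHoop.algebra B)
    value s = ⟦_⟧ (WajsbergHoop.algebra B) s ρ
    cases : Dec (corank (ρ zero) ≡ 0) →
            value (separator Π) ≈ value (𝕩 ·ᵗ boolean (suc size) 𝕩)
    cases (yes c≡0) = ≈-trans (at-infinitesimal ρ c≡0)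
      (≈-sym (≈-trans (·-cong ≈-refl (boolean-⊤ (suc size) 𝕩 ρ c≡0)) (identityʳ _)))
    cases (no  c≢0) = ≈-trans (elsewhere ρ c≢0)
      (≈-sym (≈-trans (·-cong ≈-refl (boolean-⊥ ≤-refl 𝕩 ρ c≢0)) (⊥-zeroʳ _)))

  -- The separator on each kind of generator.

  I≢0 : ∀ {i} → i ∈ I → i ≢ 0
  I≢0 i∈I = ≢-nonZero⁻¹ _ {{All.lookup I-positive i∈I}}

  J≢0 : ∀ {j} → j ∈ J → j ≢ 0
  J≢0 j∈J = ≢-nonZero⁻¹ _ {{All.lookup J-positive j∈J}}

  -- The argument is ⊥ and the term is deflationary. This settles the quotient 1 on `𝐒 i`, for i in
  -- I₁ and I₂ alike.
  𝐒-⊥ : ∀ i ρ → 𝐒-layers.corank i (ρ zero) ≡ i →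
         ⟦_⟧ (WajsbergHoop.algebra (𝐒 i)) (separator Π) ρ ≡ zero
  𝐒-⊥ i ρ c≡i = corank-injective (≤-antisym (Layered.corank≤ layered y)
    (≤-trans (≤-reflexive (sym c≡i)) (m∸n≡0⇒m≤n (trans (sym (corank-⇒ y (ρ zero)))
      (trans (cong corank (separator-lower (WajsbergHoop.isHoop (𝐒 i)) Π ρ)) corank-⊤)))))
    where
    open 𝐒-layers i
    y : Fin (suc i)
    y = ⟦_⟧ (WajsbergHoop.algebra (𝐒 i)) (separator Π) ρ

  -- For corank strictly between 0 and i the denominator divides i and is not 1, so coprimality
  -- keeps it from dividing an element of J₂.
  I₁-identical : ∀ {i} → i ∈ I₁ → Identical (𝐒 i)
  I₁-identical {i} i∈I₁ ρ with 𝐒-layers.corank i (ρ zero) ≟ i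
  ... | yes c≡i = trans (𝐒-⊥ i ρ c≡i) (sym (𝐒-layers.corank-injective i c≡i))
  ... | no  c≢i = separator-𝕩 (𝐒 i) (I≢0 (I₁⊆I i∈I₁)) layered (∈-++⁺ˡ i∈) i∈ ρ avoids
    where
    open 𝐒-layers i
    i∈ : i ∈ I₁ ++ J₁
    i∈ = ∈-++⁺ˡ i∈I₁
    avoids : corank (ρ zero) ≢ 0 → ∀ k → suc k * gcd (corank (ρ zero)) i ≡ i → ¬ Any (suc k ∣_) J₂
    avoids c≢0 k eq divides-J₂ with find divides-J₂
    ... | l , l∈J₂ , k∣l = cofactor≢1 k c≢0 (≤∧≢⇒< (Layered.corank≤ layered (ρ zero)) c≢i) eq
      (common-divisor i∈ (∈-++⁺ʳ I₂ l∈J₂) (cofactor-∣ {corank (ρ zero)} k eq) k∣l)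

  -- An element of J₁ forces J₂ to be empty, so every denominator is accepted, 1 included.
  J₁-identical : ∀ {j} → j ∈ J₁ → Identical (𝐒ω j)
  J₁-identical {j} j∈J₁ ρ =
    separator-𝕩 (𝐒ω j) j≢0 (𝐒ω-layers.layered j≢0) (∈-++⁺ˡ j∈) j∈ ρ avoids
    where
    j≢0 : j ≢ 0
    j≢0 = J≢0 (J₁⊆J j∈J₁)
    j∈ : j ∈ I₁ ++ J₁
    j∈ = ∈-++⁺ʳ I₁ j∈J₁
    J₂≡[] : J₂ ≡ []
    J₂≡[] with J-choice
    ... | inj₁ (_ , J₂≡[]) = J₂≡[]
    ... | inj₂ (J₁≡[] , _) with () ← subst (j ∈_) J₁≡[] j∈J₁
    avoids : 𝐒ω-layers.corank j≢0 (ρ zero) ≢ 0 → ∀ k →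
             suc k * gcd (𝐒ω-layers.corank j≢0 (ρ zero)) j ≡ j → ¬ Any (suc k ∣_) J₂
    avoids _ k _ divides-J₂ with () ← subst (Any (suc k ∣_)) J₂≡[] divides-J₂

  I₂-collapsing : ∀ {i} → i ∈ I₂ → Collapsing (𝐒 i)
  I₂-collapsing {i} i∈I₂ = record
    { size≢0           = i≢0
    ; layered          = layered
    ; at-infinitesimal = separator-infinitesimal (𝐒 i) i≢0 layered i∈
    ; elsewhere        = elsewhere
    }
    where
    open 𝐒-layers i
    i≢0 : i ≢ 0
    i≢0 = I≢0 (I₂⊆I i∈I₂)
    i∈ : i ∈ (I₁ ++ J₁) ++ (I₂ ++ J₂)
    i∈ = ∈-++⁺ʳ (I₁ ++ J₁) (∈-++⁺ˡ i∈I₂)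
    elsewhere : ∀ ρ → corank (ρ zero) ≢ 0 → ⟦_⟧ (WajsbergHoop.algebra (𝐒 i)) (separator Π) ρ ≡ zero
    elsewhere ρ c≢0 with corank (ρ zero) ≟ i
    ... | yes c≡i = 𝐒-⊥ i ρ c≡i
    -- A denominator dividing an element of I₁ ∪ J₁ also divides i in I₂, so it would be 1,
    -- impossible for 0 < c < i.
    ... | no  c≢i = separator-⊥ (𝐒 i) i≢0 layered i∈ ρ c≢0 λ k eq divides-W →
      let (m , m∈ , k∣m) = find divides-W in
      contradiction
        (common-divisor m∈ (∈-++⁺ˡ i∈I₂) k∣m (cofactor-∣ {corank (ρ zero)} k eq))
        (cofactor≢1 k c≢0 (≤∧≢⇒< (Layered.corank≤ layered (ρ zero)) c≢i) eq)

  -- Every denominator that occurs divides j itself, an element of J₂, and is rejected.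
  J₂-collapsing : ∀ {j} → j ∈ J₂ → Collapsing (𝐒ω j)
  J₂-collapsing {j} j∈J₂ = record
    { size≢0           = j≢0
    ; layered          = layered
    ; at-infinitesimal = separator-infinitesimal (𝐒ω j) j≢0 layered j∈
    ; elsewhere        = λ ρ c≢0 → separator-⊥ (𝐒ω j) j≢0 layered j∈ ρ c≢0
        λ k eq _ → lose j∈J₂ (cofactor-∣ {corank (ρ zero)} k eq)
    }
    where
    j≢0 : j ≢ 0
    j≢0 = J≢0 (J₂⊆J j∈J₂)
    open 𝐒ω-layers j≢0
    j∈ : j ∈ (I₁ ++ J₁) ++ (I₂ ++ J₂)
    j∈ = ∈-++⁺ʳ (I₁ ++ J₁) (∈-++⁺ʳ I₂ j∈J₂)

  opaque
    unfolding separator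

    -- Every element behaves as an infinitesimal: v ⇒ v · v is v, so `boolean` yields ⊤ for every
    -- exponent.
    𝐒^ω-identical : Identical 𝐒^ω
    𝐒^ω-identical ρ = ≈-trans (·-cong ≈-refl (join-⊤ˡ b≈⊤)) (identityʳ _)
      where
      open Algebra (WajsbergHoop.algebra 𝐒^ω) using (·-cong)
      open HoopProperties (WajsbergHoop.isHoop 𝐒^ω)
      v : ℕ
      v = ⟦_⟧ (WajsbergHoop.algebra 𝐒^ω) (𝕩 ^ᵗ suc (fuel Π)) ρ
      b≈⊤ : ⟦_⟧ (WajsbergHoop.algebra 𝐒^ω) (boolean (suc (fuel Π)) 𝕩) ρ ≡ 0
      b≈⊤ = trans (⟦boolean⟧ (suc (fuel Π)) 𝕩 ρ) (trans (cong (v ∸_) (m+n∸n≡m v v)) (n∸n≡0 v))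

  -- Elements of `𝐒 i` are determined by their coranks, and i times a nonzero corank is cut off at
  -- i, the corank of ⊥.
  I₂-power : ∀ {i} → i ∈ I₂ → 𝐒 i ⊨ separator Π ≈ 𝕩 ^ᵗ i
  I₂-power {i} i∈I₂ ρ = corank-injective
    (trans (cases (corank (ρ zero) ≟ 0)) (sym (corank-^ᵗ 𝕩 i ρ)))
    where
    open 𝐒-layers i using (corank-injective)
    open Collapsing (I₂-collapsing i∈I₂)
    open LayeredProperties (WajsbergHoop.isHoop (𝐒 i)) size≢0 layered
    cases : Dec (corank (ρ zero) ≡ 0) →
            corank (⟦_⟧ (WajsbergHoop.algebra (𝐒 i)) (separator Π) ρ) ≡ (i * corank (ρ zero)) ⊓ i
    cases (yes c≡0) = trans (cong corank (at-infinitesimal ρ c≡0))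
      (trans c≡0 (sym (cong (_⊓ i) (trans (cong (i *_) c≡0) (*-zeroʳ i)))))
    cases (no  c≢0) = trans (cong corank (elsewhere ρ c≢0))
      (sym (m≥n⇒m⊓n≡n (m≤m*n i _ {{≢-nonZero c≢0}})))

  J₂-formula : ∀ {j} → j ∈ J₂ →
    𝐒ω j ⊨ separator Π ≈ 𝕩 ·ᵗ ((𝕩 ^ᵗ suc j ⇒ᵗ 𝕩 ^ᵗ (2 * suc j)) ⇒ᵗ 𝕩 ^ᵗ suc j)
  J₂-formula j∈J₂ = collapsing-formula (J₂-collapsing j∈J₂)

  generator-conuclear : ∀ B → Generator T B → Conuclear B
  generator-conuclear _ (finite i∈I) with ∈-++⁻ I₁ (Equivalence.from I-union i∈I)
  ... | inj₁ i∈I₁ = identical⇒conuclear {𝐒 _} (I₁-identical i∈I₁)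
  ... | inj₂ i∈I₂ = collapsing⇒conuclear {𝐒 _} (I₂-collapsing i∈I₂)
  generator-conuclear _ (infinite _ j∈J) with J-choice
  ... | inj₁ (J₁∼J , _) = identical⇒conuclear {𝐒ω _} (J₁-identical (Equivalence.from J₁∼J j∈J))
  ... | inj₂ (_ , J₂∼J) = collapsing⇒conuclear {𝐒ω _} (J₂-collapsing (Equivalence.from J₂∼J j∈J))
  generator-conuclear _ (unbounded _) = identical⇒conuclear {𝐒^ω} 𝐒^ω-identical

theorem5p7 : (c ℓ : Level) →
    Σ[ t ∈ (Triple → Quadruple → UnaryTerm) ]
    ((T : Triple) → IsReduced T →
    (Π : Quadruple) → IsMultiplicativeSeparation T Π →
    (∀ i → i ∈ Quadruple.I₁ Π → 𝐒 i ⊨ t T Π ≈ 𝕩)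
    × (∀ j → j ∈ Quadruple.J₁ Π → 𝐒ω j ⊨ t T Π ≈ 𝕩)
    × (∀ i → i ∈ Quadruple.I₂ Π → 𝐒 i ⊨ t T Π ≈ 𝕩 ^ᵗ i)
    × (∀ j → j ∈ Quadruple.J₂ Π →
    𝐒ω j ⊨ t T Π ≈ 𝕩 ·ᵗ ((𝕩 ^ᵗ suc j ⇒ᵗ 𝕩 ^ᵗ (2 * suc j)) ⇒ᵗ 𝕩 ^ᵗ suc j))
    × (0 ∈ Triple.K T → 𝐒^ω ⊨ t T Π ≈ 𝕩)
    × t T Π isMultiplicativeConucleusOn 𝒱 {c} {ℓ} T)
-- Effectiveness lies in the form of the witness: a function from the finite data to terms, here
-- computed from Π.
theorem5p7 c ℓ = (λ _ → separator) , λ T reduced Π separation →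
    (λ _ → I₁-identical reduced separation)
  , (λ _ → J₁-identical reduced separation)
  , (λ _ → I₂-power reduced separation)
  , (λ _ → J₂-formula reduced separation)
  , (λ _ → 𝐒^ω-identical reduced separation)
  , conucleus-on-V (separator Π) (generator-conuclear reduced separation)
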